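{- Let $\boldsymbol{b} = (b_n)_{n \geq 0}$ and $\boldsymbol{\lambda} = (\lambda_n)_{n \geq 0}$ be sequences of positive integers, and let \[ \xi(\boldsymbol{b}, \boldsymbol{\lambda}) = [0, \overline{b_0}^{\lambda_0}, \overline{b_1}^{\lambda_1}, \overline{b_2}^{\lambda_2}, \ldots] \] be the real number whose continued fraction expansion has $0$ as integer part, followed by $\lambda_0$ partial quotients equal to $b_0$, then $\lambda_1$ partial quotients equal to $b_1$, and so on. Assume that \[ \lim_{n \to \infty} b_n = \lim_{n \to \infty} \lambda_n = \lim_{n \to \infty} \frac{\log b_{n+1}}{\sum_{k=0}^{n} \lambda_k \log b_k} = +\infty. \] Then $\xi(\boldsymbol{b}, \boldsymbol{\lambda})$ is a Liouville number, and \[ w_{=2}(\xi(\boldsymbol{b}, \boldsymbol{\lambda})) = w_{=2}^{*}(\xi(\boldsymbol{b}, \boldsymbol{\lambda})) = +\infty. \]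
   Context: For a polynomial $P \in \mathbb{Z}[X]$, $H(P)$ denotes the maximum of the absolute values of its coefficients. For a real algebraic number $\alpha$, $H(\alpha) = H(P)$, where $P$ is the minimal polynomial of $\alpha$ over $\mathbb{Z}$. Let $\xi$ be real and $n \geq 1$ an integer. $w_1(\xi)$ is the supremum of the real numbers $w$ such that, for arbitrarily large $H$, there is a polynomial $P \in \mathbb{Z}[X]$ of degree at most $1$ with $H(P) \leq H$ and $0 < |P(\xi)| \leq H^{ -w}$. A real number $\xi$ is a Liouville number if $w_1(\xi) = +\infty$. $w_{=n}(\xi)$ is the supremum of the real numbers $w$ such that, for arbitrarily large $H$, there is an irreducible polynomial $P \in \mathbb{Z}[X]$ of degree exactly $n$ with $H(P) \leq H$ and $0 < |P(\xi)| \leq H^{ -w}$. $w_{=n}^{*}(\xi)$ is the supremum of the real numbers $w^{*}$ such that, for arbitrarily large $H$, there is a real algebraic number $\alpha$ of degree exactly $n$ with $H(\alpha) \leq H$ and $0 < |\xi - \alpha| \leq H(\alpha)^{ -1} H^{ -w^{*}}$. The notation $\overline{a}^{\lambda}$ inside a continued fraction means that the letter $a$ is repeated $\lambda$ times. -}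

module Defs where

open import Algebra.Bundles using (RawSemiring)
import Algebra.Definitions.RawSemiring as RawSemiringDefinitions
open import Data.Integer.Base as ℤ using (ℤ; +_; 0ℤ; 1ℤ; _⊖_)
import Data.Integer.Properties as ℤ
open import Data.List.Base using (List; []; _∷_; foldr; map)
open import Data.Nat.Base as ℕ using (ℕ; zero; suc; pred; NonZero)
open import Data.Nat.Induction using (<-rec)
open import Data.Nat.Logarithm using (⌊log₂_⌋; ⌊log₂⌋-mono-≤; ⌊log₂[2^n]⌋≡n; ⌊log₂⌊n/2⌋⌋≡⌊log₂n⌋∸1)
import Data.Nat.Properties as ℕ
open import Data.Product.Base using (_×_; _,_; ∃; ∃-syntax; proj₁; proj₂)
open import Data.Rational.Base as ℚ using (ℚ; 0ℚ; 1ℚ; ½; _/_; 1/_; ↥_; ↧_; ↧ₙ_; mkℚ)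
open import Data.Rational.Literals using (fromℤ)
import Data.Rational.Properties as ℚ
import Data.Rational.Unnormalised.Base as ℚᵘ
import Data.Rational.Unnormalised.Properties as ℚᵘ
open import Data.Rational.Solver using (module +-*-Solver)
open import Data.Sum.Base using (inj₁; inj₂)
open import Function.Base using (_∘_; _$_)
open import Level using (0ℓ)
open import Relation.Binary.PropositionalEquality
open import Relation.Nullary.Decidable.Core using (yes; no)
open import Relation.Nullary.Negation.Core using (contradiction)

module Estimates where

  dist : ℚ → ℚ → ℚ
  dist p q = ℚ.∣ p ℚ.- q ∣

  dist-sym : ∀ p q → dist p q ≡ dist q p
  dist-sym p q = trans (sym (ℚ.∣-p∣≡∣p∣ (p ℚ.- q))) (cong ℚ.∣_∣
    (solve 2 (λ p q → :- (p :- q) := q :- p) refl p q))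
    where open +-*-Solver

  ≤⇒-≤ : ∀ {p q r} → p ℚ.≤ q ℚ.+ r → p ℚ.- q ℚ.≤ r
  ≤⇒-≤ {p} {q} {r} h = subst (p ℚ.- q ℚ.≤_)
    (solve 2 (λ q r → (q :+ r) :- q := r) refl q r) (ℚ.+-monoˡ-≤ (ℚ.- q) h)
    where open +-*-Solver

  dist-≤ : ∀ {p q r} → p ℚ.≤ q ℚ.+ r → q ℚ.≤ p ℚ.+ r → dist p q ℚ.≤ r
  dist-≤ {p} {q} {r} h k with ℚ.∣p∣≡p∨∣p∣≡-p (p ℚ.- q)
  ... | inj₁ e = subst (ℚ._≤ r) (sym e) (≤⇒-≤ h)
  ... | inj₂ e = subst (ℚ._≤ r)
    (sym (trans e (solve 2 (λ p q → :- (p :- q) := q :- p) refl p q))) (≤⇒-≤ k)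
    where open +-*-Solver

  ∣∣-≤ : ∀ p q → ℚ.∣ p ∣ ℚ.≤ ℚ.∣ q ∣ ℚ.+ dist p q
  ∣∣-≤ p q = subst (λ t → ℚ.∣ t ∣ ℚ.≤ ℚ.∣ q ∣ ℚ.+ dist p q)
    (solve 2 (λ p q → q :+ (p :- q) := p) refl p q) (ℚ.∣p+q∣≤∣p∣+∣q∣ q (p ℚ.- q))
    where open +-*-Solver

  ∣∣-dist : ∀ p q → dist ℚ.∣ p ∣ ℚ.∣ q ∣ ℚ.≤ dist p q
  ∣∣-dist p q = dist-≤ (∣∣-≤ p q) (subst (λ t → ℚ.∣ q ∣ ℚ.≤ ℚ.∣ p ∣ ℚ.+ t) (dist-sym q p) (∣∣-≤ q p))

  -‿dist : ∀ p q → dist (ℚ.- p) (ℚ.- q) ≡ dist p q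
  -‿dist p q = trans
    (cong ℚ.∣_∣ (solve 2 (λ p q → (:- p) :- (:- q) := :- (p :- q)) refl p q))
    (ℚ.∣-p∣≡∣p∣ (p ℚ.- q))
    where open +-*-Solver

  +-dist : ∀ p q r s → dist (p ℚ.+ q) (r ℚ.+ s) ℚ.≤ dist p r ℚ.+ dist q s
  +-dist p q r s = subst (λ t → ℚ.∣ t ∣ ℚ.≤ dist p r ℚ.+ dist q s)
    (solve 4 (λ p q r s → (p :- r) :+ (q :- s) := (p :+ q) :- (r :+ s)) refl p q r s)
    (ℚ.∣p+q∣≤∣p∣+∣q∣ (p ℚ.- r) (q ℚ.- s))
    where open +-*-Solver

  *-dist : ∀ p q r s →
    dist (p ℚ.* q) (r ℚ.* s) ℚ.≤ ℚ.∣ p ∣ ℚ.* dist q s ℚ.+ ℚ.∣ s ∣ ℚ.* dist p r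
  *-dist p q r s = subst₂ ℚ._≤_
    (cong ℚ.∣_∣ (solve 4 (λ p q r s → p :* (q :- s) :+ s :* (p :- r) := p :* q :- r :* s) refl p q r s))
    (cong₂ ℚ._+_ (ℚ.∣p*q∣≡∣p∣*∣q∣ p (q ℚ.- s)) (ℚ.∣p*q∣≡∣p∣*∣q∣ s (p ℚ.- r)))
    (ℚ.∣p+q∣≤∣p∣+∣q∣ (p ℚ.* (q ℚ.- s)) (s ℚ.* (p ℚ.- r)))
    where open +-*-Solver

  0<½* : ∀ {ε} → 0ℚ ℚ.< ε → 0ℚ ℚ.< ½ ℚ.* ε
  0<½* {ε} ε>0 = subst (ℚ._< ½ ℚ.* ε) (ℚ.*-zeroʳ ½) (ℚ.*-monoʳ-<-pos ½ ε>0)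

  ½+½ : ∀ ε → ½ ℚ.* ε ℚ.+ ½ ℚ.* ε ≡ ε
  ½+½ ε = trans (sym (ℚ.*-distribʳ-+ ε ½ ½)) (ℚ.*-identityˡ ε)

  toℚᵘ-/ : ∀ i n → ℚ.toℚᵘ (i / suc n) ℚᵘ.≃ ℚᵘ.mkℚᵘ i n
  toℚᵘ-/ i n = ℚ.toℚᵘ-fromℚᵘ (ℚᵘ.mkℚᵘ i n)

  /-≤ : ∀ i m j n → i ℤ.* + suc n ℤ.≤ j ℤ.* + suc m → i / suc m ℚ.≤ j / suc n
  /-≤ i m j n h = ℚ.toℚᵘ-cancel-≤ (ℚᵘ.≤-respˡ-≃ (ℚᵘ.≃-sym (toℚᵘ-/ i m))
    (ℚᵘ.≤-respʳ-≃ (ℚᵘ.≃-sym (toℚᵘ-/ j n)) (ℚᵘ.*≤* h)))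

  suc/ : ∀ j n → + suc j / suc n ≡ + j / suc n ℚ.+ 1ℤ / suc n
  suc/ j n = ℚ.toℚᵘ-injective $ ℚᵘ.≃-trans (toℚᵘ-/ (+ suc j) n) $ ℚᵘ.≃-sym $
    ℚᵘ.≃-trans (ℚ.toℚᵘ-homo-+ (+ j / suc n) (1ℤ / suc n)) $
    ℚᵘ.≃-trans (ℚᵘ.+-cong (toℚᵘ-/ (+ j) n) (toℚᵘ-/ 1ℤ n)) $ ℚᵘ.*≡* $
    trans (cong (ℤ._* + suc n) (trans (sym (ℤ.*-distribʳ-+ (+ suc n) (+ j) 1ℤ))
                                 (cong (λ t → + t ℤ.* + suc n) (ℕ.+-comm j 1))))
          (ℤ.*-assoc (+ suc j) (+ suc n) (+ suc n))

  archimedean : ∀ {ε} → 0ℚ ℚ.< ε → ∃[ N ] 1ℤ / suc N ℚ.< ε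
  archimedean {mkℚ (+ zero) d c} ε>0 = contradiction (ℚ.drop-*<* ε>0) λ { (ℤ.+<+ ()) }
  archimedean {mkℚ (ℤ.-[1+ n ]) d c} ε>0 = contradiction (ℚ.drop-*<* ε>0) λ ()
  archimedean {mkℚ (+ suc k) d c} _ = suc d , ℚ.toℚᵘ-cancel-<
    (ℚᵘ.<-respˡ-≃ (ℚᵘ.≃-sym (toℚᵘ-/ 1ℤ (suc d))) (ℚᵘ.*<* (ℤ.+<+
      (ℕ.<-≤-trans (ℕ.≤-<-trans (ℕ.≤-reflexive (ℕ.*-identityˡ (suc d))) (ℕ.n<1+n (suc d)))
                   (ℕ.m≤n*m (suc (suc d)) (suc k))))))

open Estimates

-- Real numbers: Cauchy sequences of rationals, with the equality _≃_.
-- The arithmetic operations act termwise.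
record ℝ : Set where
  constructor mkℝ
  field
    seq    : ℕ → ℚ
    cauchy : ∀ {ε} → 0ℚ ℚ.< ε →
             ∃[ N ] ∀ {m n} → N ℕ.≤ m → N ℕ.≤ n → ℚ.∣ seq m ℚ.- seq n ∣ ℚ.< ε

open ℝ public

infix  3 _⟶+∞ _∕_⟶+∞
infix  4 _<_ _≤_ _≃_ _≤_↑_ _≈ₚ_
infixl 6 _+_ _-_ _+ₚ_
infixl 7 _*_ _*ₚ_
infix  8 -_
infixr 8 _^_

_<_ : ℝ → ℝ → Set
x < y = ∃[ ε ] (0ℚ ℚ.< ε) × (∃[ N ] ∀ n → N ℕ.≤ n → seq x n ℚ.+ ε ℚ.≤ seq y n)

_≤_ : ℝ → ℝ → Set
x ≤ y = ∀ {ε} → 0ℚ ℚ.< ε → ∃[ N ] ∀ n → N ℕ.≤ n → seq x n ℚ.≤ seq y n ℚ.+ ε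

_≃_ : ℝ → ℝ → Set
x ≃ y = (x ≤ y) × (y ≤ x)

fromℚ : ℚ → ℝ
fromℚ p = mkℝ (λ _ → p) λ {ε} ε>0 →
  0 , λ _ _ → subst (ℚ._< ε) (cong ℚ.∣_∣ (sym (ℚ.+-inverseʳ p))) ε>0

fromInt : ℤ → ℝ
fromInt i = fromℚ (fromℤ i)

fromℕ : ℕ → ℝ
fromℕ n = fromInt (+ n)

0ℝ 1ℝ : ℝ
0ℝ = fromℕ 0
1ℝ = fromℕ 1

-_ : ℝ → ℝ
- x = mkℝ (λ n → ℚ.- seq x n) λ {ε} ε>0 → let N , h = cauchy x ε>0 in
  N , λ {m} {n} N≤m N≤n → subst (ℚ._< ε) (sym (-‿dist (seq x m) (seq x n))) (h N≤m N≤n)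

∣_∣ : ℝ → ℝ
∣ x ∣ = mkℝ (λ n → ℚ.∣ seq x n ∣) λ ε>0 → let N , h = cauchy x ε>0 in
  N , λ {m} {n} N≤m N≤n → ℚ.≤-<-trans (∣∣-dist (seq x m) (seq x n)) (h N≤m N≤n)

_+_ : ℝ → ℝ → ℝ
x + y = mkℝ (λ n → seq x n ℚ.+ seq y n) λ {ε} ε>0 →
  let M , h = cauchy x (0<½* ε>0)
      N , k = cauchy y (0<½* ε>0)
  in M ℕ.⊔ N , λ {m} {n} ≤m ≤n → ℚ.≤-<-trans (+-dist (seq x m) (seq y m) (seq x n) (seq y n))
       (subst (_ ℚ.<_) (½+½ ε) (ℚ.+-mono-<
         (h (ℕ.m⊔n≤o⇒m≤o M N ≤m) (ℕ.m⊔n≤o⇒m≤o M N ≤n))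
         (k (ℕ.m⊔n≤o⇒n≤o M N ≤m) (ℕ.m⊔n≤o⇒n≤o M N ≤n))))

_-_ : ℝ → ℝ → ℝ
x - y = x + (- y)

module Bounds where
  eventuallyBounded : ∀ x → ∃[ K ] ℚ.Positive K × ∃[ N ] ∀ n → N ℕ.≤ n → ℚ.∣ seq x n ∣ ℚ.≤ K
  eventuallyBounded x = let N , h = cauchy x {1ℚ} (ℚ.positive⁻¹ 1ℚ) in
    ℚ.∣ seq x N ∣ ℚ.+ 1ℚ ,
    ℚ.nonNeg+pos⇒pos ℚ.∣ seq x N ∣ {{ℚ.∣-∣-nonNeg (seq x N)}} 1ℚ ,
    N , λ n N≤n → ℚ.≤-trans (∣∣-≤ (seq x n) (seq x N))
      (ℚ.+-monoʳ-≤ ℚ.∣ seq x N ∣ (ℚ.<⇒≤ (h N≤n ℕ.≤-refl)))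

  scaledCauchy : ∀ x K → ℚ.Positive K → ∀ {ε} → 0ℚ ℚ.< ε →
    ∃[ N ] ∀ {m n} → N ℕ.≤ m → N ℕ.≤ n → K ℚ.* dist (seq x m) (seq x n) ℚ.< ε
  scaledCauchy x K K>0 {ε} ε>0 =
    let N , h = cauchy x {K⁻¹ ℚ.* ε} (subst (ℚ._< K⁻¹ ℚ.* ε) (ℚ.*-zeroʳ K⁻¹)
                  (ℚ.*-monoʳ-<-pos K⁻¹ {{ℚ.1/pos⇒pos K}} ε>0))
    in N , λ N≤m N≤n → subst (_ ℚ.<_)
      (trans (sym (ℚ.*-assoc K K⁻¹ ε)) (trans (cong (ℚ._* ε) (ℚ.*-inverseʳ K)) (ℚ.*-identityˡ ε)))
      (ℚ.*-monoʳ-<-pos K (h N≤m N≤n))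
    where
    instance
      K-positive = K>0
      K-nonZero  = ℚ.pos⇒nonZero K
    K⁻¹ = 1/ K

open Bounds

_*_ : ℝ → ℝ → ℝ
x * y = mkℝ (λ n → seq x n ℚ.* seq y n) λ {ε} ε>0 →
  let K , K>0 , A , a = eventuallyBounded x
      L , L>0 , B , b = eventuallyBounded y
      C , c = scaledCauchy y K K>0 (0<½* ε>0)
      D , d = scaledCauchy x L L>0 (0<½* ε>0)
      AB = A ℕ.⊔ B
      CD = C ℕ.⊔ D
  in AB ℕ.⊔ CD , λ {m} {n} ≤m ≤n →
       let AB≤m = ℕ.m⊔n≤o⇒m≤o AB CD ≤m
           AB≤n = ℕ.m⊔n≤o⇒m≤o AB CD ≤n
           CD≤m = ℕ.m⊔n≤o⇒n≤o AB CD ≤m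
           CD≤n = ℕ.m⊔n≤o⇒n≤o AB CD ≤n
           dx = dist (seq x m) (seq x n)
           dy = dist (seq y m) (seq y n)
       in ℚ.≤-<-trans (*-dist (seq x m) (seq y m) (seq x n) (seq y n))
          (ℚ.≤-<-trans (ℚ.+-mono-≤
             (ℚ.*-monoʳ-≤-nonNeg dy {{ℚ.∣-∣-nonNeg (seq y m ℚ.- seq y n)}} (a m (ℕ.m⊔n≤o⇒m≤o A B AB≤m)))
             (ℚ.*-monoʳ-≤-nonNeg dx {{ℚ.∣-∣-nonNeg (seq x m ℚ.- seq x n)}} (b n (ℕ.m⊔n≤o⇒n≤o A B AB≤n))))
          (subst (_ ℚ.<_) (½+½ ε) (ℚ.+-mono-<
             (c (ℕ.m⊔n≤o⇒m≤o C D CD≤m) (ℕ.m⊔n≤o⇒m≤o C D CD≤n))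
             (d (ℕ.m⊔n≤o⇒n≤o C D CD≤m) (ℕ.m⊔n≤o⇒n≤o C D CD≤n)))))

_^_ : ℝ → ℕ → ℝ
x ^ zero  = 1ℝ
x ^ suc n = x * x ^ n

∑[0…_] : ℕ → (ℕ → ℝ) → ℝ
∑[0… zero  ] f = f 0
∑[0… suc n ] f = ∑[0… n ] f + f (suc n)

-- y = H ^ w for a real base H ≥ 1 and a real exponent w.  As H ^ r is
-- nondecreasing in r, this says that H ^ r ≤ y for all rationals r < w and
-- y ≤ H ^ r for all rationals r > w.  For r = (i - j) / (k + 1) these
-- inequalities are raised to the power k + 1 and multiplied by H ^ j.
record IsPower (H w y : ℝ) : Set where
  field
    base≥1   : 1ℝ ≤ H
    positive : 0ℝ < y
    below    : ∀ i j k → fromℚ ((i ⊖ j) / suc k) < w → H ^ i ≤ H ^ j * y ^ suc k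
    above    : ∀ i j k → w < fromℚ ((i ⊖ j) / suc k) → H ^ j * y ^ suc k ≤ H ^ i

-- x ≤ H ^ w
_≤_↑_ : ℝ → ℝ → ℝ → Set
x ≤ H ↑ w = ∃[ y ] IsPower H w y × x ≤ y

module FloorLog where
  n<2^[1+⌊log₂n⌋] : ∀ n → n ℕ.< 2 ℕ.^ suc ⌊log₂ n ⌋
  n<2^[1+⌊log₂n⌋] n with n ℕ.<? 2 ℕ.^ suc ⌊log₂ n ⌋
  ... | yes p = p
  ... | no ¬p = contradiction
    (subst (ℕ._≤ ⌊log₂ n ⌋) (⌊log₂[2^n]⌋≡n (suc ⌊log₂ n ⌋)) (⌊log₂⌋-mono-≤ (ℕ.≮⇒≥ ¬p)))
    ℕ.1+n≰n

  2*⌊n/2⌋≤n : ∀ n → 2 ℕ.* ℕ.⌊ n /2⌋ ℕ.≤ n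
  2*⌊n/2⌋≤n n = ℕ.≤-trans
    (ℕ.≤-reflexive (cong (ℕ.⌊ n /2⌋ ℕ.+_) (ℕ.+-identityʳ ℕ.⌊ n /2⌋)))
    (ℕ.≤-trans (ℕ.+-monoʳ-≤ ℕ.⌊ n /2⌋ (ℕ.⌊n/2⌋≤⌈n/2⌉ n)) (ℕ.≤-reflexive (ℕ.⌊n/2⌋+⌈n/2⌉≡n n)))

  2^⌊log₂n⌋≤n : ∀ n → .{{NonZero n}} → 2 ℕ.^ ⌊log₂ n ⌋ ℕ.≤ n
  2^⌊log₂n⌋≤n = <-rec (λ n → .{{NonZero n}} → 2 ℕ.^ ⌊log₂ n ⌋ ℕ.≤ n) step
    where
    step : ∀ n → (∀ {m} → m ℕ.< n → .{{NonZero m}} → 2 ℕ.^ ⌊log₂ m ⌋ ℕ.≤ m) →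
           .{{NonZero n}} → 2 ℕ.^ ⌊log₂ n ⌋ ℕ.≤ n
    step 1 _ = ℕ.≤-refl
    step n@(suc (suc k)) rec = begin
      2 ℕ.^ ⌊log₂ n ⌋                      ≤⟨ ℕ.^-monoʳ-≤ 2 (ℕ.m≤n+m∸n ⌊log₂ n ⌋ 1) ⟩
      2 ℕ.* 2 ℕ.^ (⌊log₂ n ⌋ ℕ.∸ 1)        ≡⟨ cong (λ t → 2 ℕ.* 2 ℕ.^ t) (⌊log₂⌊n/2⌋⌋≡⌊log₂n⌋∸1 n) ⟨
      2 ℕ.* 2 ℕ.^ ⌊log₂ ℕ.⌊ n /2⌋ ⌋        ≤⟨ ℕ.*-monoʳ-≤ 2 (rec (ℕ.⌊n/2⌋<n (suc k))) ⟩
      2 ℕ.* ℕ.⌊ n /2⌋                      ≤⟨ 2*⌊n/2⌋≤n n ⟩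
      n                                    ∎
      where open ℕ.≤-Reasoning

  module _ (b : ℕ) .{{_ : NonZero b}} where

    lg : ℕ → ℕ
    lg n = ⌊log₂ (b ℕ.^ suc n) ⌋

    lg-cross : ∀ m n → lg m ℕ.* suc n ℕ.≤ suc (lg n) ℕ.* suc m
    lg-cross m n = ℕ.≮⇒≥ λ lt → ℕ.<⇒≱ (ℕ.^-monoʳ-< 2 (ℕ.s≤s (ℕ.s≤s ℕ.z≤n)) lt) (begin
      2 ℕ.^ (lg m ℕ.* suc n)           ≡⟨ ℕ.^-*-assoc 2 (lg m) (suc n) ⟨
      (2 ℕ.^ lg m) ℕ.^ suc n           ≤⟨ ℕ.^-monoˡ-≤ (suc n)
                                            (2^⌊log₂n⌋≤n (b ℕ.^ suc m) {{ℕ.m^n≢0 b (suc m)}}) ⟩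
      (b ℕ.^ suc m) ℕ.^ suc n          ≡⟨ ℕ.^-*-assoc b (suc m) (suc n) ⟩
      b ℕ.^ (suc m ℕ.* suc n)          ≡⟨ cong (b ℕ.^_) (ℕ.*-comm (suc m) (suc n)) ⟩
      b ℕ.^ (suc n ℕ.* suc m)          ≡⟨ ℕ.^-*-assoc b (suc n) (suc m) ⟨
      (b ℕ.^ suc n) ℕ.^ suc m          ≤⟨ ℕ.^-monoˡ-≤ (suc m) (ℕ.<⇒≤ (n<2^[1+⌊log₂n⌋] (b ℕ.^ suc n))) ⟩
      (2 ℕ.^ suc (lg n)) ℕ.^ suc m     ≡⟨ ℕ.^-*-assoc 2 (suc (lg n)) (suc m) ⟩
      2 ℕ.^ (suc (lg n) ℕ.* suc m)     ∎)
      where open ℕ.≤-Reasoning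

    lg-≤ : ∀ N m n → N ℕ.≤ n → + lg m / suc m ℚ.≤ + lg n / suc n ℚ.+ 1ℤ / suc N
    lg-≤ N m n N≤n = ℚ.≤-trans
      (subst (+ lg m / suc m ℚ.≤_) (suc/ (lg n) n)
        (/-≤ (+ lg m) m (+ suc (lg n)) n
          (subst₂ ℤ._≤_ (ℤ.pos-* (lg m) (suc n)) (ℤ.pos-* (suc (lg n)) (suc m)) (ℤ.+≤+ (lg-cross m n)))))
      (ℚ.+-monoʳ-≤ (+ lg n / suc n)
        (/-≤ 1ℤ n 1ℤ N (subst₂ ℤ._≤_ (sym (ℤ.*-identityˡ (+ suc N))) (sym (ℤ.*-identityˡ (+ suc n)))
          (ℤ.+≤+ (ℕ.s≤s N≤n)))))

open FloorLog

-- ⌊log₂ bⁿ⌋ / n differs from log₂ b by less than 1 / n.  Base 2 is a harmless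
-- normalisation: only quotients of logarithms are used.
log₂ : (b : ℕ) → .{{NonZero b}} → ℝ
log₂ b = mkℝ (λ n → + ⌊log₂ (b ℕ.^ suc n) ⌋ / suc n) λ ε>0 →
  let N , h = archimedean ε>0 in
  N , λ {m} {n} N≤m N≤n → ℚ.≤-<-trans (dist-≤ (lg-≤ b N m n N≤n) (lg-≤ b N n m N≤m)) h

_⟶+∞ : (ℕ → ℝ) → Set
f ⟶+∞ = ∀ M → ∃[ N ] ∀ n → N ℕ.≤ n → M < f n

-- f n / g n → +∞, where the quotient need only be defined for large n.
-- (For b₀ = 1 the first denominators Σ λₖ log bₖ vanish.)
_∕_⟶+∞ : (ℕ → ℝ) → (ℕ → ℝ) → Set
f ∕ g ⟶+∞ = ∀ M → ∃[ N ] ∀ n → N ℕ.≤ n → (0ℝ < g n) × (M * g n < f n)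

sup_≡+∞ : (ℝ → Set) → Set
sup S ≡+∞ = ∀ M → ∃[ w ] S w × M < w

ForArbitrarilyLarge : (ℝ → Set) → Set
ForArbitrarilyLarge Q = ∀ H₀ → ∃[ H ] (H₀ ≤ H) × Q H

-- Coefficients with the constant term first, up to trailing zeros.
Poly : Set
Poly = List ℤ

coeff : Poly → ℕ → ℤ
coeff []      _       = 0ℤ
coeff (a ∷ P) zero    = a
coeff (a ∷ P) (suc i) = coeff P i

_≈ₚ_ : Poly → Poly → Set
P ≈ₚ Q = ∀ i → coeff P i ≡ coeff Q i

_+ₚ_ : Poly → Poly → Poly
[]      +ₚ Q       = Q
(a ∷ P) +ₚ []      = a ∷ P
(a ∷ P) +ₚ (b ∷ Q) = (a ℤ.+ b) ∷ (P +ₚ Q)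

_*ₚ_ : Poly → Poly → Poly
[]      *ₚ Q = []
(a ∷ P) *ₚ Q = map (a ℤ.*_) Q +ₚ (0ℤ ∷ (P *ₚ Q))

ℤ[X] : RawSemiring 0ℓ 0ℓ
ℤ[X] = record
  { Carrier = Poly
  ; _≈_     = _≈ₚ_
  ; _+_     = _+ₚ_
  ; _*_     = _*ₚ_
  ; 0#      = []
  ; 1#      = 1ℤ ∷ []
  }

open RawSemiringDefinitions ℤ[X] public using (Irreducible)

DegreeAtMost : Poly → ℕ → Set
DegreeAtMost P d = ∀ i → d ℕ.< i → coeff P i ≡ 0ℤ

HasDegree : Poly → ℕ → Set
HasDegree P d = coeff P d ≢ 0ℤ × DegreeAtMost P d

height : Poly → ℕ
height P = foldr ℕ._⊔_ 0 (map ℤ.∣_∣ P)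

eval : Poly → ℝ → ℝ
eval []      x = 0ℝ
eval (a ∷ P) x = fromInt a + x * eval P x

-- Irreducibility in ℤ[X] includes primitivity; the sign is normalised by the
-- leading coefficient.
record AlgebraicReal : Set where
  field
    value       : ℝ
    minPoly     : Poly
    degree      : ℕ
    hasDegree   : HasDegree minPoly degree
    lead>0      : 0ℤ ℤ.< coeff minPoly degree
    irreducible : Irreducible minPoly
    root        : eval minPoly value ≃ 0ℝ

open AlgebraicReal public

heightₐ : AlgebraicReal → ℕ
heightₐ α = height (minPoly α)

-- ExponentsFor, w₁, w₌ and w₌* are the sets of exponents; the quantities of the
-- same name are their suprema.
ExponentsFor : (Poly → Set) → ℝ → ℝ → Set
ExponentsFor 𝒫 ξ w = ForArbitrarilyLarge λ H → ∃[ P ]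
  𝒫 P × (fromℕ (height P) ≤ H) × (0ℝ < ∣ eval P ξ ∣) × (∣ eval P ξ ∣ ≤ H ↑ (- w))

w₁ : ℝ → ℝ → Set
w₁ = ExponentsFor λ P → DegreeAtMost P 1

w₌ : ℕ → ℝ → ℝ → Set
w₌ n = ExponentsFor λ P → Irreducible P × HasDegree P n

-- ∣ ξ - α ∣ ≤ H(α)⁻¹ H ^ (- w) is multiplied by H(α).
w₌* : ℕ → ℝ → ℝ → Set
w₌* n ξ w = ForArbitrarilyLarge λ H → ∃[ α ]
  (degree α ≡ n) × (fromℕ (heightₐ α) ≤ H) ×
  (0ℝ < ∣ ξ - value α ∣) × (fromℕ (heightₐ α) * ∣ ξ - value α ∣ ≤ H ↑ (- w))

Liouville : ℝ → Set
Liouville ξ = sup w₁ ξ ≡+∞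

Pos : (ℕ → ℕ) → Set
Pos a = ∀ n → NonZero (a n)

fromℤ-pos : ∀ n → .{{NonZero n}} → ℚ.Positive (fromℤ (+ n))
fromℤ-pos (suc n) = _

-- convergent a _ n = [0, a 0, a 1, …, a (n - 1)]
mutual

  convergent : (a : ℕ → ℕ) → Pos a → ℕ → ℚ
  convergent a a⁺ zero    = 0ℚ
  convergent a a⁺ (suc n) = 1/_ (denominator a a⁺ n) {{denominator-nonZero a a⁺ n}}

  denominator : (a : ℕ → ℕ) → Pos a → ℕ → ℚ
  denominator a a⁺ n = fromℤ (+ a 0) ℚ.+ convergent (a ∘ suc) (a⁺ ∘ suc) n

  denominator-pos : ∀ a (a⁺ : Pos a) n → ℚ.Positive (denominator a a⁺ n)
  denominator-pos a a⁺ n = ℚ.pos+nonNeg⇒pos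
    (fromℤ (+ a 0)) {{fromℤ-pos (a 0) {{a⁺ 0}}}}
    (convergent (a ∘ suc) (a⁺ ∘ suc) n) {{convergent-nonNeg (a ∘ suc) (a⁺ ∘ suc) n}}

  denominator-nonZero : ∀ a (a⁺ : Pos a) n → ℚ.NonZero (denominator a a⁺ n)
  denominator-nonZero a a⁺ n = ℚ.pos⇒nonZero (denominator a a⁺ n) {{denominator-pos a a⁺ n}}

  convergent-nonNeg : ∀ a (a⁺ : Pos a) n → ℚ.NonNegative (convergent a a⁺ n)
  convergent-nonNeg a a⁺ zero    = _
  convergent-nonNeg a a⁺ (suc n) = ℚ.pos⇒nonNeg (convergent a a⁺ (suc n))
    {{ℚ.1/pos⇒pos (denominator a a⁺ n) {{denominator-pos a a⁺ n}}}}

module Contraction where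
  1≤fromℤ : ∀ n → .{{NonZero n}} → 1ℚ ℚ.≤ fromℤ (+ n)
  1≤fromℤ (suc n) = ℚ.*≤* (subst₂ ℤ._≤_ (sym (ℤ.*-identityˡ 1ℤ)) (sym (ℤ.*-identityʳ (+ suc n)))
    (ℤ.+≤+ (ℕ.s≤s ℕ.z≤n)))

  1≤denominator : ∀ a (a⁺ : Pos a) n → 1ℚ ℚ.≤ denominator a a⁺ n
  1≤denominator a a⁺ n = subst (ℚ._≤ denominator a a⁺ n) (ℚ.+-identityʳ 1ℚ)
    (ℚ.+-mono-≤ (1≤fromℤ (a 0) {{a⁺ 0}})
      (ℚ.nonNegative⁻¹ (convergent (a ∘ suc) (a⁺ ∘ suc) n) {{convergent-nonNeg (a ∘ suc) (a⁺ ∘ suc) n}}))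

  convergent*denominator : ∀ a (a⁺ : Pos a) n →
    convergent a a⁺ (suc n) ℚ.* denominator a a⁺ n ≡ 1ℚ
  convergent*denominator a a⁺ n =
    ℚ.*-inverseˡ (denominator a a⁺ n) {{denominator-nonZero a a⁺ n}}

  convergent≤1 : ∀ a (a⁺ : Pos a) n → convergent a a⁺ n ℚ.≤ 1ℚ
  convergent≤1 a a⁺ zero    = ℚ.<⇒≤ (ℚ.positive⁻¹ 1ℚ)
  convergent≤1 a a⁺ (suc n) = subst₂ ℚ._≤_ (ℚ.*-identityʳ x) (convergent*denominator a a⁺ n)
    (ℚ.*-monoˡ-≤-nonNeg x {{convergent-nonNeg a a⁺ (suc n)}} (1≤denominator a a⁺ n))
    where x = convergent a a⁺ (suc n)

  -- consecutive tails x = 1 / (A + t) satisfy x t ≤ 1/2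
  tails≤½ : ∀ a (a⁺ : Pos a) n →
    convergent a a⁺ (suc n) ℚ.* convergent (a ∘ suc) (a⁺ ∘ suc) n ℚ.≤ ½
  tails≤½ a a⁺ n = subst₂ ℚ._≤_
    (trans (ℚ.*-distribˡ-+ ½ (x ℚ.* t) (x ℚ.* t)) (½+½ (x ℚ.* t)))
    (trans (cong (½ ℚ.*_) (convergent*denominator a a⁺ n)) (ℚ.*-identityʳ ½))
    (ℚ.*-monoˡ-≤-nonNeg ½ (subst (ℚ._≤ x ℚ.* denominator a a⁺ n)
      (ℚ.*-distribˡ-+ x t t)
      (ℚ.*-monoˡ-≤-nonNeg x {{convergent-nonNeg a a⁺ (suc n)}} (ℚ.+-monoˡ-≤ t
        (ℚ.≤-trans (convergent≤1 (a ∘ suc) (a⁺ ∘ suc) n) (1≤fromℤ (a 0) {{a⁺ 0}}))))))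
    where
    x = convergent a a⁺ (suc n)
    t = convergent (a ∘ suc) (a⁺ ∘ suc) n

  reciprocal-dist : ∀ A s t x y → x ℚ.* (A ℚ.+ s) ≡ 1ℚ → y ℚ.* (A ℚ.+ t) ≡ 1ℚ →
    ℚ.NonNegative x → ℚ.NonNegative y → dist x y ≡ (x ℚ.* y) ℚ.* dist s t
  reciprocal-dist A s t x y xs yt x⁺ y⁺ = begin
    dist x y                                                ≡⟨ cong₂ dist (sym (ℚ.*-identityʳ x)) (sym (ℚ.*-identityʳ y)) ⟩
    dist (x ℚ.* 1ℚ) (y ℚ.* 1ℚ)                              ≡⟨ cong₂ (λ u v → dist (x ℚ.* u) (y ℚ.* v)) yt xs ⟨
    dist (x ℚ.* (y ℚ.* (A ℚ.+ t))) (y ℚ.* (x ℚ.* (A ℚ.+ s)))  ≡⟨ cong ℚ.∣_∣ (solve 5 (λ A s t x y →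
        x :* (y :* (A :+ t)) :- y :* (x :* (A :+ s)) := (x :* y) :* (t :- s)) refl A s t x y) ⟩
    ℚ.∣ (x ℚ.* y) ℚ.* (t ℚ.- s) ∣                           ≡⟨ ℚ.∣p*q∣≡∣p∣*∣q∣ (x ℚ.* y) (t ℚ.- s) ⟩
    ℚ.∣ x ℚ.* y ∣ ℚ.* dist t s                              ≡⟨ cong₂ ℚ._*_ (ℚ.0≤p⇒∣p∣≡p (ℚ.nonNegative⁻¹ (x ℚ.* y)
                                                                  {{ℚ.nonNeg*nonNeg⇒nonNeg x {{x⁺}} y {{y⁺}}}}))
                                                                (dist-sym t s) ⟩
    (x ℚ.* y) ℚ.* dist s t                                  ∎
    where
    open ≡-Reasoning
    open +-*-Solver

  convergent-step : ∀ a (a⁺ : Pos a) m n →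
    dist (convergent a a⁺ (suc m)) (convergent a a⁺ (suc n)) ≡
    (convergent a a⁺ (suc m) ℚ.* convergent a a⁺ (suc n)) ℚ.*
      dist (convergent (a ∘ suc) (a⁺ ∘ suc) m) (convergent (a ∘ suc) (a⁺ ∘ suc) n)
  convergent-step a a⁺ m n = reciprocal-dist (fromℤ (+ a 0))
    (convergent (a ∘ suc) (a⁺ ∘ suc) m) (convergent (a ∘ suc) (a⁺ ∘ suc) n)
    (convergent a a⁺ (suc m)) (convergent a a⁺ (suc n))
    (convergent*denominator a a⁺ m) (convergent*denominator a a⁺ n)
    (convergent-nonNeg a a⁺ (suc m)) (convergent-nonNeg a a⁺ (suc n))

  contraction : ∀ a (a⁺ : Pos a) m n →
    dist (convergent a a⁺ (2 ℕ.+ m)) (convergent a a⁺ (2 ℕ.+ n)) ℚ.≤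
    ½ ℚ.* dist (convergent (a ∘ suc ∘ suc) (a⁺ ∘ suc ∘ suc) m) (convergent (a ∘ suc ∘ suc) (a⁺ ∘ suc ∘ suc) n)
  contraction a a⁺ m n = begin
    dist x y                               ≡⟨ convergent-step a a⁺ (suc m) (suc n) ⟩
    (x ℚ.* y) ℚ.* dist s t                 ≡⟨ cong ((x ℚ.* y) ℚ.*_) (convergent-step (a ∘ suc) (a⁺ ∘ suc) m n) ⟩
    (x ℚ.* y) ℚ.* ((s ℚ.* t) ℚ.* d)        ≡⟨ solve 5 (λ x y s t d →
      (x :* y) :* ((s :* t) :* d) := ((x :* s) :* (y :* t)) :* d) refl x y s t d ⟩
    ((x ℚ.* s) ℚ.* (y ℚ.* t)) ℚ.* d        ≤⟨ ℚ.*-monoʳ-≤-nonNeg d {{ℚ.∣-∣-nonNeg (u ℚ.- v)}} xsyt≤½ ⟩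
    ½ ℚ.* d                                ∎
    where
    open ℚ.≤-Reasoning
    open +-*-Solver
    x = convergent a a⁺ (2 ℕ.+ m)
    y = convergent a a⁺ (2 ℕ.+ n)
    s = convergent (a ∘ suc) (a⁺ ∘ suc) (suc m)
    t = convergent (a ∘ suc) (a⁺ ∘ suc) (suc n)
    u = convergent (a ∘ suc ∘ suc) (a⁺ ∘ suc ∘ suc) m
    v = convergent (a ∘ suc ∘ suc) (a⁺ ∘ suc ∘ suc) n
    d = dist u v
    ½≤1 : ½ ℚ.≤ 1ℚ
    ½≤1 = ℚ.≤ᵇ⇒≤ _
    xsyt≤½ : (x ℚ.* s) ℚ.* (y ℚ.* t) ℚ.≤ ½
    xsyt≤½ = ℚ.≤-trans
      (ℚ.*-monoˡ-≤-nonNeg (x ℚ.* s)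
        {{ℚ.nonNeg*nonNeg⇒nonNeg x {{convergent-nonNeg a a⁺ (2 ℕ.+ m)}}
                                 s {{convergent-nonNeg (a ∘ suc) (a⁺ ∘ suc) (suc m)}}}}
        (ℚ.≤-trans (tails≤½ a a⁺ (suc n)) ½≤1))
      (ℚ.≤-trans (ℚ.≤-reflexive (ℚ.*-identityʳ (x ℚ.* s))) (tails≤½ a a⁺ (suc m)))

  halve : ∀ k → ½ ℚ.* (1ℤ / suc k) ℚ.≤ 1ℤ / suc (suc k)
  halve k = ℚ.toℚᵘ-cancel-≤
    (ℚᵘ.≤-respˡ-≃ (ℚᵘ.≃-sym (ℚᵘ.≃-trans (ℚ.toℚᵘ-homo-* ½ (1ℤ / suc k))
                              (ℚᵘ.*-congˡ {ℚ.toℚᵘ ½} (toℚᵘ-/ 1ℤ k))))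
    (ℚᵘ.≤-respʳ-≃ (ℚᵘ.≃-sym (toℚᵘ-/ 1ℤ (suc k)))
    (ℚᵘ.*≤* (ℤ.+≤+ (ℕ.+-monoˡ-≤ 0 (ℕ.s≤s (subst (ℕ._≤ k ℕ.+ suc (k ℕ.+ 0)) (ℕ.+-comm k 1)
      (ℕ.+-monoʳ-≤ k (ℕ.s≤s ℕ.z≤n)))))))))

  convergents-close : ∀ a (a⁺ : Pos a) k {m n} → k ℕ.+ k ℕ.≤ m → k ℕ.+ k ℕ.≤ n →
    dist (convergent a a⁺ m) (convergent a a⁺ n) ℚ.≤ 1ℤ / suc k
  convergents-close a a⁺ zero {m} {n} _ _ = dist-≤
    (bound m n) (bound n m)
    where
    bound : ∀ m n → convergent a a⁺ m ℚ.≤ convergent a a⁺ n ℚ.+ 1ℚ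
    bound m n = ℚ.≤-trans (convergent≤1 a a⁺ m) (subst (ℚ._≤ convergent a a⁺ n ℚ.+ 1ℚ) (ℚ.+-identityˡ 1ℚ)
      (ℚ.+-monoˡ-≤ 1ℚ (ℚ.nonNegative⁻¹ (convergent a a⁺ n) {{convergent-nonNeg a a⁺ n}})))
  convergents-close a a⁺ (suc k) ≤m ≤n
    rewrite ℕ.+-suc k k with ℕ.s≤s (ℕ.s≤s {n = m′} ≤m′) ← ≤m | ℕ.s≤s (ℕ.s≤s {n = n′} ≤n′) ← ≤n =
    ℚ.≤-trans (contraction a a⁺ m′ n′) (ℚ.≤-trans
      (ℚ.*-monoˡ-≤-nonNeg ½ (convergents-close (a ∘ suc ∘ suc) (a⁺ ∘ suc ∘ suc) k ≤m′ ≤n′))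
      (halve k))

open Contraction

-- [0, a 0, a 1, a 2, …]
continuedFraction : (a : ℕ → ℕ) → Pos a → ℝ
continuedFraction a a⁺ = mkℝ (convergent a a⁺) λ ε>0 →
  let k , h = archimedean ε>0 in
  k ℕ.+ k , λ ≤m ≤n → ℚ.≤-<-trans (convergents-close a a⁺ k ≤m ≤n) h

-- The word (b k)^(1 + r) (b (k + 1))^(l (k + 1)) (b (k + 2))^(l (k + 2)) …,
-- for l positive.
blocksFrom : (b l : ℕ → ℕ) (k r : ℕ) → ℕ → ℕ
blocksFrom b l k r       zero    = b k
blocksFrom b l k (suc r) (suc i) = blocksFrom b l k r i
blocksFrom b l k zero    (suc i) = blocksFrom b l (suc k) (pred (l (suc k))) i

blocks : (b l : ℕ → ℕ) → ℕ → ℕ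
blocks b l = blocksFrom b l 0 (pred (l 0))

blocksFrom-pos : ∀ {b} l → Pos b → ∀ k r → Pos (blocksFrom b l k r)
blocksFrom-pos l b⁺ k r       zero    = b⁺ k
blocksFrom-pos l b⁺ k (suc r) (suc i) = blocksFrom-pos l b⁺ k r i
blocksFrom-pos l b⁺ k zero    (suc i) = blocksFrom-pos l b⁺ (suc k) (pred (l (suc k))) i

blockFraction : (b l : ℕ → ℕ) → Pos b → ℝ
blockFraction b l b⁺ = continuedFraction (blocks b l) (blocksFrom-pos l b⁺ 0 (pred (l 0)))

{-# OPTIONS --safe #-}
module Submission where

-- Prepending a letter k to a continued fraction t gives x = 1 / (k + t).  For a
-- polynomial G of degree e, the polynomial F(x) = x ^ e G (1 / x - k) satisfies
-- F(x) (k + t) ^ e = G(t); for e ≤ 2 its height is at most (k + 1) ^ e times that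
-- of G, and for e = 2 the discriminant and primitivity are those of G.
-- Let W n = ∏ (bₖ + 1) ^ λₖ over k ≤ n, the cost of prepending the blocks
-- 0, …, n.  The logarithmic hypothesis makes b₍ₙ₊₁₎ exceed any fixed power of W n.
--
-- Starting from G = X at the block n + 1 gives a linear polynomial of height at
-- most W n whose value at ξ is at most 1 / b₍ₙ₊₁₎; thus ξ is a Liouville number.
-- Write c = b₍ₙ₊₁₎.  Starting instead from G = X² + c X - 1, whose root is
-- [0, c, c, …], gives a primitive polynomial P of discriminant c² + 4, which is
-- not a square, and of height at most c (W n)² ≤ c³.  As G is only changed in sign
-- by prepending c, each letter of the block n + 1 gains a factor c², so that
-- ∣ P(ξ) ∣ and the distance from ξ to a root of P are at most c ^ (- 2 λ₍ₙ₊₁₎),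
-- where λ₍ₙ₊₁₎ → ∞.  They are nonzero because b₍ₙ₊₂₎ is much larger than c.

import Algebra.Definitions.RawMagma as Divides
import Algebra.Definitions.RawSemiring
open import Data.Integer.Base as ℤ using (ℤ; +_; 0ℤ; 1ℤ; _⊖_)
import Data.Integer.Properties as ℤ
import Data.Integer.Solver
open import Data.List.Base using ([]; _∷_; map)
open import Data.Nat.Base as ℕ using (ℕ; zero; suc; pred; NonZero)
open import Data.Nat.Logarithm using (⌊log₂_⌋)
import Data.Nat.Properties as ℕ
import Data.Nat.Solver
open import Data.Product.Base using (_×_; _,_; ∃-syntax; Σ-syntax; proj₁; proj₂)
open import Data.Rational.Base as ℚ using (ℚ; 0ℚ; 1ℚ; mkℚ; _/_)
open import Data.Rational.Literals using (fromℤ)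
import Data.Rational.Properties as ℚ
import Data.Rational.Solver
import Data.Rational.Unnormalised.Base as ℚᵘ
import Data.Rational.Unnormalised.Properties as ℚᵘ
open import Data.Sum.Base as Sum using (_⊎_; inj₁; inj₂)
open import Function.Base using (_∘_; _$_)
open import Relation.Binary.Definitions using (tri<; tri≈; tri>)
open import Relation.Binary.PropositionalEquality
open import Relation.Nullary.Decidable.Core using (yes; no)
open import Relation.Nullary.Negation.Core using (¬_; contradiction)
open import Defs

open Algebra.Definitions.RawSemiring ℤ[X] using () renaming (_∣_ to _∣ₚ_)
open Estimates
open Bounds
open FloorLog
open Contraction

private
  module ℚ-Solver where
    open Data.Rational.Solver.+-*-Solver public using (solve; _:=_; _:+_; _:*_; _:-_; :-_; con)
  module ℕ-Solver where
    open Data.Nat.Solver.+-*-Solver public using (solve; _:=_; _:+_; _:*_; con)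
  module ℤ-Solver where
    open Data.Integer.Solver.+-*-Solver public using (solve; _:=_; _:+_; _:*_; _:-_; :-_; con)

-- Rational arithmetic

fromℤ-+ : ∀ i j → fromℤ (i ℤ.+ j) ≡ fromℤ i ℚ.+ fromℤ j
fromℤ-+ i j = ℚ.toℚᵘ-injective $ ℚᵘ.≃-sym $
  ℚᵘ.≃-trans (ℚ.toℚᵘ-homo-+ (fromℤ i) (fromℤ j)) $ ℚᵘ.*≡* $
  cong (ℤ._* 1ℤ) (cong₂ ℤ._+_ (ℤ.*-identityʳ i) (ℤ.*-identityʳ j))

fromℤ-* : ∀ i j → fromℤ (i ℤ.* j) ≡ fromℤ i ℚ.* fromℤ j
fromℤ-* i j = ℚ.toℚᵘ-injective $ ℚᵘ.≃-sym $
  ℚᵘ.≃-trans (ℚ.toℚᵘ-homo-* (fromℤ i) (fromℤ j)) $ ℚᵘ.*≡* refl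

fromℤ-neg : ∀ i → fromℤ (ℤ.- i) ≡ ℚ.- fromℤ i
fromℤ-neg (+ zero)    = refl
fromℤ-neg (+ suc n)   = refl
fromℤ-neg ℤ.-[1+ n ]  = refl

fromℤ-mono : ∀ {i j} → i ℤ.≤ j → fromℤ i ℚ.≤ fromℤ j
fromℤ-mono {i} {j} h = ℚ.*≤* (subst₂ ℤ._≤_ (sym (ℤ.*-identityʳ i)) (sym (ℤ.*-identityʳ j)) h)

fromℤ-cancel : ∀ {i j} → fromℤ i ℚ.≤ fromℤ j → i ℤ.≤ j
fromℤ-cancel {i} {j} h = subst₂ ℤ._≤_ (ℤ.*-identityʳ i) (ℤ.*-identityʳ j) (ℚ.drop-*≤* h)

⟦_⟧ : ℕ → ℚ
⟦ n ⟧ = fromℤ (+ n)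

⟦⟧-+ : ∀ m n → ⟦ m ℕ.+ n ⟧ ≡ ⟦ m ⟧ ℚ.+ ⟦ n ⟧
⟦⟧-+ m n = fromℤ-+ (+ m) (+ n)

⟦⟧-* : ∀ m n → ⟦ m ℕ.* n ⟧ ≡ ⟦ m ⟧ ℚ.* ⟦ n ⟧
⟦⟧-* m n = trans (cong fromℤ (ℤ.pos-* m n)) (fromℤ-* (+ m) (+ n))

⟦⟧-mono : ∀ {m n} → m ℕ.≤ n → ⟦ m ⟧ ℚ.≤ ⟦ n ⟧
⟦⟧-mono h = fromℤ-mono (ℤ.+≤+ h)

⟦⟧-cancel : ∀ {m n} → ⟦ m ⟧ ℚ.≤ ⟦ n ⟧ → m ℕ.≤ n
⟦⟧-cancel h = ℤ.drop‿+≤+ (fromℤ-cancel h)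

⟦⟧-nonNeg : ∀ n → 0ℚ ℚ.≤ ⟦ n ⟧
⟦⟧-nonNeg n = ⟦⟧-mono ℕ.z≤n

*-monoˡ : ∀ {p q r} → 0ℚ ℚ.≤ r → p ℚ.≤ q → r ℚ.* p ℚ.≤ r ℚ.* q
*-monoˡ {r = r} r≥0 = ℚ.*-monoˡ-≤-nonNeg r {{ℚ.nonNegative r≥0}}

*-monoʳ : ∀ {p q r} → 0ℚ ℚ.≤ r → p ℚ.≤ q → p ℚ.* r ℚ.≤ q ℚ.* r
*-monoʳ {r = r} r≥0 = ℚ.*-monoʳ-≤-nonNeg r {{ℚ.nonNegative r≥0}}

*-mono : ∀ {p q r s} → 0ℚ ℚ.≤ p → 0ℚ ℚ.≤ s → p ℚ.≤ q → r ℚ.≤ s → p ℚ.* r ℚ.≤ q ℚ.* s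
*-mono p≥0 s≥0 p≤q r≤s = ℚ.≤-trans (*-monoˡ p≥0 r≤s) (*-monoʳ s≥0 p≤q)

*-nonNeg : ∀ {p q} → 0ℚ ℚ.≤ p → 0ℚ ℚ.≤ q → 0ℚ ℚ.≤ p ℚ.* q
*-nonNeg {p} {q} p≥0 q≥0 = subst (ℚ._≤ p ℚ.* q) (ℚ.*-zeroʳ p) (*-monoˡ p≥0 q≥0)

+-nonNeg : ∀ {p q} → 0ℚ ℚ.≤ p → 0ℚ ℚ.≤ q → 0ℚ ℚ.≤ p ℚ.+ q
+-nonNeg p≥0 q≥0 = ℚ.+-mono-≤ p≥0 q≥0

p≤p+q : ∀ {p q} → 0ℚ ℚ.≤ q → p ℚ.≤ p ℚ.+ q
p≤p+q {p} q≥0 = subst (ℚ._≤ p ℚ.+ _) (ℚ.+-identityʳ p) (ℚ.+-monoʳ-≤ p q≥0)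

*-cancel-≤ : ∀ {p q r} → 0ℚ ℚ.< r → r ℚ.* p ℚ.≤ r ℚ.* q → p ℚ.≤ q
*-cancel-≤ {r = r} r>0 = ℚ.*-cancelˡ-≤-pos r {{ℚ.positive r>0}}

0<1 : 0ℚ ℚ.< 1ℚ
0<1 = ℚ.positive⁻¹ 1ℚ

0≤1 : 0ℚ ℚ.≤ 1ℚ
0≤1 = ℚ.<⇒≤ 0<1

1≤⇒0< : ∀ {p} → 1ℚ ℚ.≤ p → 0ℚ ℚ.< p
1≤⇒0< = ℚ.<-≤-trans 0<1

recip : ℕ → ℚ
recip n = 1ℤ / suc n

⟦⟧*recip : ∀ n → ⟦ suc n ⟧ ℚ.* recip n ≡ 1ℚ
⟦⟧*recip n = ℚ.toℚᵘ-injective $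
  ℚᵘ.≃-trans (ℚ.toℚᵘ-homo-* ⟦ suc n ⟧ (recip n)) $
  ℚᵘ.≃-trans (ℚᵘ.*-congˡ {ℚ.toℚᵘ ⟦ suc n ⟧} (toℚᵘ-/ 1ℤ n)) $
  ℚᵘ.*≡* $ trans (ℤ.*-identityʳ _) (trans (ℤ.*-identityʳ (+ suc n))
    (sym (trans (ℤ.*-identityˡ _) (ℤ.*-identityˡ (+ suc n)))))

recip>0 : ∀ n → 0ℚ ℚ.< recip n
recip>0 n = ℚ.*-cancelˡ-<-nonNeg ⟦ suc n ⟧ (subst₂ ℚ._<_ (sym (ℚ.*-zeroʳ ⟦ suc n ⟧)) (sym (⟦⟧*recip n)) 0<1)

upperℕ : ∀ p → ∃[ n ] p ℚ.≤ ⟦ n ⟧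
upperℕ (mkℚ i d c) = ℤ.∣ i ∣ , ℚ.*≤* (ℤ.≤-trans (ℤ.≤-reflexive (ℤ.*-identityʳ i)) (ℤ.≤-trans (i≤∣i∣ i)
    (subst (ℤ._≤ + ℤ.∣ i ∣ ℤ.* + suc d) (ℤ.*-identityʳ (+ ℤ.∣ i ∣))
      (ℤ.*-monoˡ-≤-nonNeg (+ ℤ.∣ i ∣) (ℤ.+≤+ (ℕ.s≤s ℕ.z≤n))))))
  where
  i≤∣i∣ : ∀ i → i ℤ.≤ + ℤ.∣ i ∣
  i≤∣i∣ (+ n)      = ℤ.≤-refl
  i≤∣i∣ ℤ.-[1+ n ] = ℤ.-≤+

p≤∣p∣ : ∀ p → p ℚ.≤ ℚ.∣ p ∣
p≤∣p∣ p with ℚ.≤-total 0ℚ p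
... | inj₁ p≥0 = ℚ.≤-reflexive (sym (ℚ.0≤p⇒∣p∣≡p p≥0))
... | inj₂ p≤0 = ℚ.≤-trans p≤0 (ℚ.0≤∣p∣ p)

-- Real numbers

boundℕ : ∀ x → ∃[ h ] ∃[ N ] ∀ n → N ℕ.≤ n → seq x n ℚ.≤ ⟦ h ⟧
boundℕ x = let K , _ , N , p = eventuallyBounded x ; h , K≤h = upperℕ K in
  h , N , λ n N≤n → ℚ.≤-trans (ℚ.≤-trans (p≤∣p∣ (seq x n)) (p n N≤n)) K≤h

≤-eventually : ∀ x y N → (∀ n → N ℕ.≤ n → seq x n ℚ.≤ seq y n) → x ≤ y
≤-eventually x y N h ε>0 = N , λ n N≤n → ℚ.≤-trans (h n N≤n) (p≤p+q (ℚ.<⇒≤ ε>0))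

≤-fromℕ : ∀ x → ∃[ h₀ ] ∀ {h} → h₀ ℕ.≤ h → x ≤ fromℕ h
≤-fromℕ x = let h₀ , N , p = boundℕ x in h₀ , λ {h} h₀≤h →
  ≤-eventually x (fromℕ h) N λ n N≤n → ℚ.≤-trans (p n N≤n) (⟦⟧-mono h₀≤h)

-- Because of this, a set of exponents that contains every natural number has supremum `+∞`, so only
-- exponents `fromℕ m` need to be treated below.
<-fromℕ : ∀ x → ∃[ h ] x < fromℕ h
<-fromℕ x = let h , N , p = boundℕ x in suc h , 1ℚ , 0<1 , N , λ n N≤n →
  ℚ.≤-trans (ℚ.+-monoˡ-≤ 1ℚ (p n N≤n))
    (ℚ.≤-reflexive (trans (ℚ.+-comm ⟦ h ⟧ 1ℚ) (sym (⟦⟧-+ 1 h))))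

fromℕ-mono : ∀ {m n} → m ℕ.≤ n → fromℕ m ≤ fromℕ n
fromℕ-mono {m} {n} h = ≤-eventually (fromℕ m) (fromℕ n) 0 λ _ _ → ⟦⟧-mono h

fromℕ-<-cancel : ∀ {m n} → fromℕ m < fromℕ n → m ℕ.< n
fromℕ-<-cancel {m} {n} (ε , ε>0 , N , h) = ℕ.≰⇒> λ n≤m → impossible (ℚ.≤-trans (h N ℕ.≤-refl) (⟦⟧-mono n≤m))
  where
  impossible : ¬ (⟦ m ⟧ ℚ.+ ε ℚ.≤ ⟦ m ⟧)
  impossible k = ℚ.<-irrefl refl (ℚ.<-≤-trans
      (subst (ℚ._< ⟦ m ⟧ ℚ.+ ε) (ℚ.+-identityʳ ⟦ m ⟧) (ℚ.+-monoʳ-< ⟦ m ⟧ ε>0)) k)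

-- Powers with a negative integer exponent

/-* : ∀ z k → z / suc k ℚ.* ⟦ suc k ⟧ ≡ fromℤ z
/-* z k = ℚ.toℚᵘ-injective $
  ℚᵘ.≃-trans (ℚ.toℚᵘ-homo-* (z / suc k) ⟦ suc k ⟧) $
  ℚᵘ.≃-trans (ℚᵘ.*-congʳ {ℚ.toℚᵘ ⟦ suc k ⟧} (toℚᵘ-/ z k)) $
  ℚᵘ.*≡* $ trans (ℤ.*-identityʳ _) (cong (z ℤ.*_) (sym (ℤ.*-identityʳ (+ suc k))))

seq-fromℕ-^ : ∀ h i n → seq (fromℕ h ^ i) n ≡ ⟦ h ℕ.^ i ⟧
seq-fromℕ-^ h zero    n = refl
seq-fromℕ-^ h (suc i) n = trans (cong (⟦ h ⟧ ℚ.*_) (seq-fromℕ-^ h i n)) (sym (⟦⟧-* h (h ℕ.^ i)))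

fromℚ-^-inverse : ∀ d y → ⟦ d ⟧ ℚ.* y ≡ 1ℚ → ∀ k n → ⟦ d ℕ.^ k ⟧ ℚ.* seq (fromℚ y ^ k) n ≡ 1ℚ
fromℚ-^-inverse d y dy≡1 zero    n = refl
fromℚ-^-inverse d y dy≡1 (suc k) n = begin
  ⟦ d ℕ.* d ℕ.^ k ⟧ ℚ.* (y ℚ.* Y)         ≡⟨ cong (ℚ._* (y ℚ.* Y)) (⟦⟧-* d (d ℕ.^ k)) ⟩
  (⟦ d ⟧ ℚ.* ⟦ d ℕ.^ k ⟧) ℚ.* (y ℚ.* Y)   ≡⟨ solve 4 (λ a b c e →
    (a :* b) :* (c :* e) := (a :* c) :* (b :* e)) refl ⟦ d ⟧ ⟦ d ℕ.^ k ⟧ y Y ⟩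
  (⟦ d ⟧ ℚ.* y) ℚ.* (⟦ d ℕ.^ k ⟧ ℚ.* Y)   ≡⟨ cong₂ ℚ._*_ dy≡1 (fromℚ-^-inverse d y dy≡1 k n) ⟩
  1ℚ ℚ.* 1ℚ                               ≡⟨⟩
  1ℚ                                      ∎
  where
  open ≡-Reasoning
  open ℚ-Solver
  Y = seq (fromℚ y ^ k) n

-- Adding j + p to both sides turns a comparison of the integers i - j and -p into one of natural
-- numbers.
module _ (i j p : ℕ) where

  private
    open ℤ-Solver

    shift-⊖ : i ⊖ j ℤ.+ (+ j ℤ.+ + p) ≡ + (i ℕ.+ p)
    shift-⊖ = trans (cong (ℤ._+ (+ j ℤ.+ + p)) (sym (ℤ.m-n≡m⊖n i j)))
      (solve 3 (λ i j p → i :- j :+ (j :+ p) := i :+ p) refl (+ i) (+ j) (+ p))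

    shift-neg : ℤ.- + p ℤ.+ (+ j ℤ.+ + p) ≡ + j
    shift-neg = solve 2 (λ j p → :- p :+ (j :+ p) := j) refl (+ j) (+ p)

  ⊖-≤-neg : i ⊖ j ℤ.≤ ℤ.- + p → i ℕ.+ p ℕ.≤ j
  ⊖-≤-neg h = ℤ.drop‿+≤+ (subst₂ ℤ._≤_ shift-⊖ shift-neg (ℤ.+-monoˡ-≤ (+ j ℤ.+ + p) h))

  neg-≤-⊖ : ℤ.- + p ℤ.≤ i ⊖ j → j ℕ.≤ i ℕ.+ p
  neg-≤-⊖ h = ℤ.drop‿+≤+ (subst₂ ℤ._≤_ shift-neg shift-⊖ (ℤ.+-monoˡ-≤ (+ j ℤ.+ + p) h))

neg-⟦⟧-* : ∀ m k → (ℚ.- ⟦ m ⟧) ℚ.* ⟦ suc k ⟧ ≡ fromℤ (ℤ.- + (m ℕ.* suc k))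
neg-⟦⟧-* m k = trans (sym (ℚ.neg-distribˡ-* ⟦ m ⟧ ⟦ suc k ⟧))
  (trans (cong ℚ.-_ (sym (⟦⟧-* m (suc k)))) (sym (fromℤ-neg (+ (m ℕ.* suc k)))))

/-≤-neg : ∀ i j k m → (i ⊖ j) / suc k ℚ.≤ ℚ.- ⟦ m ⟧ → i ℕ.+ m ℕ.* suc k ℕ.≤ j
/-≤-neg i j k m h = ⊖-≤-neg i j (m ℕ.* suc k) (fromℤ-cancel
  (subst₂ ℚ._≤_ (/-* (i ⊖ j) k) (neg-⟦⟧-* m k) (*-monoʳ (⟦⟧-nonNeg (suc k)) h)))

neg-≤-/ : ∀ i j k m → ℚ.- ⟦ m ⟧ ℚ.≤ (i ⊖ j) / suc k → j ℕ.≤ i ℕ.+ m ℕ.* suc k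
neg-≤-/ i j k m h = neg-≤-⊖ i j (m ℕ.* suc k) (fromℤ-cancel
  (subst₂ ℚ._≤_ (neg-⟦⟧-* m k) (/-* (i ⊖ j) k) (*-monoʳ (⟦⟧-nonNeg (suc k)) h)))

fromℚ-<⇒≤ : ∀ {p q} → fromℚ p < fromℚ q → p ℚ.≤ q
fromℚ-<⇒≤ (ε , ε>0 , N , h) = ℚ.≤-trans (p≤p+q (ℚ.<⇒≤ ε>0)) (h N ℕ.≤-refl)

inverse>0 : ∀ d y → ⟦ d ⟧ ℚ.* y ≡ 1ℚ → 0ℚ ℚ.< y
inverse>0 d y dy≡1 = ℚ.*-cancelˡ-<-nonNeg ⟦ d ⟧ {{ℚ.nonNegative (⟦⟧-nonNeg d)}}
  (subst₂ ℚ._<_ (sym (ℚ.*-zeroʳ ⟦ d ⟧)) (sym dy≡1) 0<1)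

module _ (h m : ℕ) .{{_ : NonZero h}} (y : ℚ) (hᵐy≡1 : ⟦ h ℕ.^ m ⟧ ℚ.* y ≡ 1ℚ) where

  private
    h^i : ∀ i k n → ⟦ h ℕ.^ (i ℕ.+ m ℕ.* suc k) ⟧ ℚ.* seq (fromℚ y ^ suc k) n ≡ ⟦ h ℕ.^ i ⟧
    h^i i k n = begin
      ⟦ h ℕ.^ (i ℕ.+ m ℕ.* suc k) ⟧ ℚ.* Y               ≡⟨ cong (λ t → ⟦ t ⟧ ℚ.* Y)
        (trans (ℕ.^-distribˡ-+-* h i (m ℕ.* suc k)) (cong (h ℕ.^ i ℕ.*_) (sym (ℕ.^-*-assoc h m (suc k))))) ⟩
      ⟦ h ℕ.^ i ℕ.* (h ℕ.^ m) ℕ.^ suc k ⟧ ℚ.* Y         ≡⟨ cong (ℚ._* Y) (⟦⟧-* (h ℕ.^ i) ((h ℕ.^ m) ℕ.^ suc k)) ⟩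
      ⟦ h ℕ.^ i ⟧ ℚ.* ⟦ (h ℕ.^ m) ℕ.^ suc k ⟧ ℚ.* Y     ≡⟨ ℚ.*-assoc ⟦ h ℕ.^ i ⟧ ⟦ (h ℕ.^ m) ℕ.^ suc k ⟧ Y ⟩
      ⟦ h ℕ.^ i ⟧ ℚ.* (⟦ (h ℕ.^ m) ℕ.^ suc k ⟧ ℚ.* Y)   ≡⟨ cong (⟦ h ℕ.^ i ⟧ ℚ.*_)
        (fromℚ-^-inverse (h ℕ.^ m) y hᵐy≡1 (suc k) n) ⟩
      ⟦ h ℕ.^ i ⟧ ℚ.* 1ℚ                                ≡⟨ ℚ.*-identityʳ _ ⟩
      ⟦ h ℕ.^ i ⟧                                       ∎
      where
      open ≡-Reasoning
      Y = seq (fromℚ y ^ suc k) n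

    y^k≥0 : ∀ k n → 0ℚ ℚ.≤ seq (fromℚ y ^ k) n
    y^k≥0 zero    n = 0≤1
    y^k≥0 (suc k) n = *-nonNeg (ℚ.<⇒≤ (inverse>0 (h ℕ.^ m) y hᵐy≡1)) (y^k≥0 k n)

  -- Here y = h ^ (-m), so h ^ i = h ^ (i + m (k + 1)) y ^ (k + 1). Both conditions thus compare the
  -- exponents j and i + m (k + 1), and this is the comparison of (i - j) / (k + 1) with -m after
  -- clearing the denominator.
  isPower : IsPower (fromℕ h) (- fromℕ m) (fromℚ y)
  isPower = record
    { base≥1   = fromℕ-mono (ℕ.>-nonZero⁻¹ h)
    ; positive = y , y>0 , 0 , λ _ _ → ℚ.≤-reflexive (ℚ.+-identityˡ y)
    ; below    = λ i j k lt → ≤-eventually (fromℕ h ^ i) (fromℕ h ^ j * fromℚ y ^ suc k) 0 λ n _ →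
        subst₂ ℚ._≤_ (trans (h^i i k n) (sym (seq-fromℕ-^ h i n)))
          (cong (ℚ._* seq (fromℚ y ^ suc k) n) (sym (seq-fromℕ-^ h j n)))
          (*-monoʳ (y^k≥0 (suc k) n) (⟦⟧-mono (ℕ.^-monoʳ-≤ h (/-≤-neg i j k m (fromℚ-<⇒≤ lt)))))
    ; above    = λ i j k lt → ≤-eventually (fromℕ h ^ j * fromℚ y ^ suc k) (fromℕ h ^ i) 0 λ n _ →
        subst₂ ℚ._≤_ (cong (ℚ._* seq (fromℚ y ^ suc k) n) (sym (seq-fromℕ-^ h j n)))
          (trans (h^i i k n) (sym (seq-fromℕ-^ h i n)))
          (*-monoʳ (y^k≥0 (suc k) n) (⟦⟧-mono (ℕ.^-monoʳ-≤ h (neg-≤-/ i j k m (fromℚ-<⇒≤ lt)))))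
    }
    where y>0 = inverse>0 (h ℕ.^ m) y hᵐy≡1

-- Integer scales D, k in place of bounds 1 / D, 1 / k keep these conditions
-- multiplicative and free of division.

Small : (ℕ → ℚ) → ℕ → Set
Small v D = ∃[ N ] ∀ n → N ℕ.≤ n → ⟦ D ⟧ ℚ.* v n ℚ.≤ 1ℚ

Apart : (ℕ → ℚ) → Set
Apart v = ∃[ k ] ∃[ N ] ∀ n → N ℕ.≤ n → 1ℚ ℚ.≤ ⟦ k ⟧ ℚ.* v n

Small⇒≤↑ : ∀ x h m .{{_ : NonZero h}} → Small (seq x) (h ℕ.^ m) → x ≤ fromℕ h ↑ (- fromℕ m)
Small⇒≤↑ x h m (N , s) = fromℚ y , isPower h m y hᵐy≡1 , ≤-eventually x (fromℚ y) N λ n N≤n →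
  *-cancel-≤ {r = ⟦ h ℕ.^ m ⟧} (1≤⇒0< (⟦⟧-mono hᵐ>0))
    (subst (⟦ h ℕ.^ m ⟧ ℚ.* seq x n ℚ.≤_) (sym hᵐy≡1) (s n N≤n))
  where
  hᵐ>0 : 0 ℕ.< h ℕ.^ m
  hᵐ>0 = ℕ.m^n>0 h m
  -- `recip n` is 1 / (n + 1), hence the predecessor; y is h ^ (-m).
  y = recip (pred (h ℕ.^ m))
  hᵐy≡1 : ⟦ h ℕ.^ m ⟧ ℚ.* y ≡ 1ℚ
  hᵐy≡1 = trans (cong (λ t → ⟦ t ⟧ ℚ.* y) (sym (ℕ.suc-pred (h ℕ.^ m) {{ℕ.>-nonZero hᵐ>0}})))
                (⟦⟧*recip (pred (h ℕ.^ m)))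

-- The strict order asks for a rational gap. The gap 1 / k serves, and k = 0 would give 1 ≤ 0.
Apart⇒>0 : ∀ x → Apart (seq x) → 0ℝ < x
Apart⇒>0 x (zero , N , a) = contradiction (a N ℕ.≤-refl)
  λ p → ℚ.<-irrefl refl (ℚ.<-≤-trans (1≤⇒0< p) (ℚ.≤-reflexive (ℚ.*-zeroˡ (seq x N))))
Apart⇒>0 x (suc k , N , a) = recip k , recip>0 k , N , λ n N≤n →
  subst (ℚ._≤ seq x n) (sym (ℚ.+-identityˡ (recip k)))
    (*-cancel-≤ {r = ⟦ suc k ⟧} (1≤⇒0< (⟦⟧-mono (ℕ.s≤s ℕ.z≤n)))
      (subst (ℚ._≤ ⟦ suc k ⟧ ℚ.* seq x n) (sym (⟦⟧*recip k)) (a n N≤n)))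

Vanishing⇒≃0 : ∀ x → (∀ D → Small (λ n → ℚ.∣ seq x n ∣) D) → x ≃ 0ℝ
Vanishing⇒≃0 x s = x≤0 , 0≤x
  where
  ∣x∣≤ : ∀ {ε} → 0ℚ ℚ.< ε → ∃[ N ] ∀ n → N ℕ.≤ n → ℚ.∣ seq x n ∣ ℚ.≤ ε
  ∣x∣≤ ε>0 = let k , 1/k<ε = archimedean ε>0 ; N , h = s (suc k) in N , λ n N≤n →
    ℚ.≤-trans (*-cancel-≤ {r = ⟦ suc k ⟧} (1≤⇒0< (⟦⟧-mono (ℕ.s≤s ℕ.z≤n)))
      (subst (⟦ suc k ⟧ ℚ.* ℚ.∣ seq x n ∣ ℚ.≤_) (sym (⟦⟧*recip k)) (h n N≤n))) (ℚ.<⇒≤ 1/k<ε)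
  x≤0 : x ≤ 0ℝ
  x≤0 {ε} ε>0 = let N , h = ∣x∣≤ ε>0 in N , λ n N≤n →
    subst (seq x n ℚ.≤_) (sym (ℚ.+-identityˡ ε)) (ℚ.≤-trans (p≤∣p∣ (seq x n)) (h n N≤n))
  0≤x : 0ℝ ≤ x
  0≤x {ε} ε>0 = let N , h = ∣x∣≤ ε>0 in N , λ n N≤n →
    subst (ℚ._≤ seq x n ℚ.+ ε) (ℚ.+-inverseʳ (seq x n)) (ℚ.+-monoʳ-≤ (seq x n)
      (ℚ.≤-trans (ℚ.≤-trans (p≤∣p∣ (ℚ.- seq x n)) (ℚ.≤-reflexive (ℚ.∣-p∣≡∣p∣ (seq x n)))) (h n N≤n)))

-- In the applications w belongs to a tail and v to the word with one letter prepended. The index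
-- shifts by one because the convergent n + 1 of the word is built from the convergent n of its
-- tail; c n is a product of denominators.
module _ {v w : ℕ → ℚ} (v≥0 : ∀ n → 0ℚ ℚ.≤ v n) (c : ℕ → ℚ)
         (scale : ∀ n → c n ℚ.* v (suc n) ≡ w n) where

  Small-step : ∀ {lo D} → (∀ n → ⟦ lo ⟧ ℚ.≤ c n) → Small w D → Small v (lo ℕ.* D)
  Small-step {lo} {D} lo≤c (N , s) = suc N , bound
    where
    open ℚ.≤-Reasoning
    bound : ∀ n → suc N ℕ.≤ n → ⟦ lo ℕ.* D ⟧ ℚ.* v n ℚ.≤ 1ℚ
    bound (suc n) (ℕ.s≤s N≤n) = ℚ.≤-trans (begin
      ⟦ lo ℕ.* D ⟧ ℚ.* v (suc n)        ≡⟨ cong (ℚ._* v (suc n)) (trans (⟦⟧-* lo D) (ℚ.*-comm ⟦ lo ⟧ ⟦ D ⟧)) ⟩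
      ⟦ D ⟧ ℚ.* ⟦ lo ⟧ ℚ.* v (suc n)    ≡⟨ ℚ.*-assoc ⟦ D ⟧ ⟦ lo ⟧ (v (suc n)) ⟩
      ⟦ D ⟧ ℚ.* (⟦ lo ⟧ ℚ.* v (suc n))  ≤⟨ *-monoˡ (⟦⟧-nonNeg D) (*-monoʳ (v≥0 (suc n)) (lo≤c n)) ⟩
      ⟦ D ⟧ ℚ.* (c n ℚ.* v (suc n))     ≡⟨ cong (⟦ D ⟧ ℚ.*_) (scale n) ⟩
      ⟦ D ⟧ ℚ.* w n                     ∎) (s n N≤n)

  Small-step₁ : ∀ {D} → (∀ n → 1ℚ ℚ.≤ c n) → Small w D → Small v D
  Small-step₁ {D} 1≤c s = subst (Small v) (ℕ.*-identityˡ D) (Small-step {1} 1≤c s)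

  Apart-step : ∀ hi → (∀ n → c n ℚ.≤ ⟦ hi ⟧) → Apart w → Apart v
  Apart-step hi c≤hi (k , N , a) = k ℕ.* hi , suc N , bound
    where
    open ℚ.≤-Reasoning
    bound : ∀ n → suc N ℕ.≤ n → 1ℚ ℚ.≤ ⟦ k ℕ.* hi ⟧ ℚ.* v n
    bound (suc n) (ℕ.s≤s N≤n) = ℚ.≤-trans (a n N≤n) (begin
      ⟦ k ⟧ ℚ.* w n                     ≡⟨ cong (⟦ k ⟧ ℚ.*_) (scale n) ⟨
      ⟦ k ⟧ ℚ.* (c n ℚ.* v (suc n))     ≤⟨ *-monoˡ (⟦⟧-nonNeg k) (*-monoʳ (v≥0 (suc n)) (c≤hi n)) ⟩
      ⟦ k ⟧ ℚ.* (⟦ hi ⟧ ℚ.* v (suc n))  ≡⟨ ℚ.*-assoc ⟦ k ⟧ ⟦ hi ⟧ (v (suc n)) ⟨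
      ⟦ k ⟧ ℚ.* ⟦ hi ⟧ ℚ.* v (suc n)    ≡⟨ cong (ℚ._* v (suc n)) (⟦⟧-* k hi) ⟨
      ⟦ k ℕ.* hi ⟧ ℚ.* v (suc n)        ∎)

-- Irreducible quadratic polynomials

-- The Cauchy product. On functions, unlike on lists, trailing zeros of a polynomial make no
-- difference.
conv : (f g : ℕ → ℤ) → ℕ → ℤ
conv f g zero    = f 0 ℤ.* g 0
conv f g (suc i) = f 0 ℤ.* g (suc i) ℤ.+ conv (f ∘ suc) g i

VanishesAbove : (ℕ → ℤ) → ℕ → Set
VanishesAbove f d = ∀ i → d ℕ.< i → f i ≡ 0ℤ

conv-zeroˡ : ∀ f g → (∀ i → f i ≡ 0ℤ) → ∀ i → conv f g i ≡ 0ℤ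
conv-zeroˡ f g f≡0 zero    = cong (ℤ._* g 0) (f≡0 0)
conv-zeroˡ f g f≡0 (suc i) = cong₂ ℤ._+_ (cong (ℤ._* g (suc i)) (f≡0 0))
                                         (conv-zeroˡ (f ∘ suc) g (f≡0 ∘ suc) i)

conv-zeroʳ : ∀ f g → (∀ i → g i ≡ 0ℤ) → ∀ i → conv f g i ≡ 0ℤ
conv-zeroʳ f g g≡0 zero    = trans (cong (f 0 ℤ.*_) (g≡0 0)) (ℤ.*-zeroʳ (f 0))
conv-zeroʳ f g g≡0 (suc i) = cong₂ ℤ._+_
  (trans (cong (f 0 ℤ.*_) (g≡0 (suc i))) (ℤ.*-zeroʳ (f 0))) (conv-zeroʳ (f ∘ suc) g g≡0 i)

conv-constˡ : ∀ f g → VanishesAbove f 0 → ∀ i → conv f g i ≡ f 0 ℤ.* g i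
conv-constˡ f g f⁰ zero    = refl
conv-constˡ f g f⁰ (suc i) = trans
  (cong (ℤ._+_ (f 0 ℤ.* g (suc i))) (conv-zeroˡ (f ∘ suc) g (λ j → f⁰ (suc j) (ℕ.s≤s ℕ.z≤n)) i))
  (ℤ.+-identityʳ _)

conv-constʳ : ∀ f g → VanishesAbove g 0 → ∀ i → conv f g i ≡ f i ℤ.* g 0
conv-constʳ f g g⁰ zero    = refl
conv-constʳ f g g⁰ (suc i) = trans (cong₂ ℤ._+_
  (trans (cong (f 0 ℤ.*_) (g⁰ (suc i) (ℕ.s≤s ℕ.z≤n))) (ℤ.*-zeroʳ (f 0)))
  (conv-constʳ (f ∘ suc) g g⁰ i)) (ℤ.+-identityˡ _)

-- Leading coefficients multiply: in position d + e every other product has a factor above its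
-- degree.
conv-top : ∀ f g d e → VanishesAbove f d → VanishesAbove g e → conv f g (d ℕ.+ e) ≡ f d ℤ.* g e
conv-top f g zero    e fᵈ gᵉ = conv-constˡ f g fᵈ e
conv-top f g (suc d) e fᵈ gᵉ = trans (cong₂ ℤ._+_
  (trans (cong (f 0 ℤ.*_) (gᵉ (suc (d ℕ.+ e)) (ℕ.s≤s (ℕ.m≤n+m e d)))) (ℤ.*-zeroʳ (f 0)))
  (conv-top (f ∘ suc) g d e (λ i d<i → fᵈ (suc i) (ℕ.s≤s d<i)) gᵉ)) (ℤ.+-identityˡ _)

coeff-+ₚ : ∀ P Q i → coeff (P +ₚ Q) i ≡ coeff P i ℤ.+ coeff Q i
coeff-+ₚ []      Q       i       = sym (ℤ.+-identityˡ _)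
coeff-+ₚ (a ∷ P) []      i       = sym (ℤ.+-identityʳ _)
coeff-+ₚ (a ∷ P) (b ∷ Q) zero    = refl
coeff-+ₚ (a ∷ P) (b ∷ Q) (suc i) = coeff-+ₚ P Q i

coeff-map : ∀ a Q i → coeff (map (a ℤ.*_) Q) i ≡ a ℤ.* coeff Q i
coeff-map a []      i       = sym (ℤ.*-zeroʳ a)
coeff-map a (b ∷ Q) zero    = refl
coeff-map a (b ∷ Q) (suc i) = coeff-map a Q i

coeff-*ₚ : ∀ P Q i → coeff (P *ₚ Q) i ≡ conv (coeff P) (coeff Q) i
coeff-*ₚ []      Q i       = sym (conv-zeroˡ (coeff []) (coeff Q) (λ _ → refl) i)
coeff-*ₚ (a ∷ P) Q zero    = trans (coeff-+ₚ (map (a ℤ.*_) Q) (0ℤ ∷ (P *ₚ Q)) 0)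
  (trans (ℤ.+-identityʳ _) (coeff-map a Q 0))
coeff-*ₚ (a ∷ P) Q (suc i) = trans (coeff-+ₚ (map (a ℤ.*_) Q) (0ℤ ∷ (P *ₚ Q)) (suc i))
  (cong₂ ℤ._+_ (coeff-map a Q (suc i)) (coeff-*ₚ P Q i))

-- Trailing zeros keep the list length from being the degree, so the last nonzero coefficient is
-- searched for, using that equality of integers is decidable.
zero⊎degree : ∀ P → (∀ i → coeff P i ≡ 0ℤ) ⊎ ∃[ d ] HasDegree P d
zero⊎degree []      = inj₁ λ _ → refl
zero⊎degree (a ∷ P) with zero⊎degree P
... | inj₂ (d , top , above) = inj₂ (suc d , top , λ { (suc i) (ℕ.s≤s d<i) → above i d<i })
... | inj₁ P≡0 with a ℤ.≟ 0ℤ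
...   | yes a≡0 = inj₁ λ { zero → a≡0 ; (suc i) → P≡0 i }
...   | no  a≢0 = inj₂ (0 , a≢0 , λ { (suc i) _ → P≡0 i })

*-≢0 : ∀ {i j} → i ≢ 0ℤ → j ≢ 0ℤ → i ℤ.* j ≢ 0ℤ
*-≢0 {i} i≢0 j≢0 ij≡0 with ℤ.i*j≡0⇒i≡0∨j≡0 i ij≡0
... | inj₁ i≡0 = i≢0 i≡0
... | inj₂ j≡0 = j≢0 j≡0

constant∣1 : ∀ X k → DegreeAtMost X 0 → k ℤ.* coeff X 0 ≡ 1ℤ → ∃[ Y ] Y *ₚ X ≈ₚ 1ℤ ∷ []
constant∣1 X k X⁰ kx≡1 = k ∷ [] , λ i → trans (coeff-*ₚ (k ∷ []) X i)
  (trans (conv-constˡ (coeff (k ∷ [])) (coeff X) (λ { (suc _) _ → refl }) i) (unit i))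
  where
  unit : ∀ i → k ℤ.* coeff X i ≡ coeff (1ℤ ∷ []) i
  unit zero    = kx≡1
  unit (suc i) = trans (cong (k ℤ.*_) (X⁰ (suc i) (ℕ.s≤s ℕ.z≤n))) (ℤ.*-zeroʳ k)

disc : (A B C : ℤ) → ℤ
disc A B C = B ℤ.* B ℤ.- + 4 ℤ.* A ℤ.* C

NonSquare : ℤ → Set
NonSquare D = ∀ z → z ℤ.* z ≢ D

-- The Bézout form of primitivity, which unimodular substitutions preserve.
Primitive : (A B C : ℤ) → Set
Primitive A B C = ∃[ u ] ∃[ v ] ∃[ w ] u ℤ.* A ℤ.+ v ℤ.* B ℤ.+ w ℤ.* C ≡ 1ℤ

module _ {A B C : ℤ} (D : NonSquare (disc A B C)) where

  private P = C ∷ B ∷ A ∷ []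

  -- For A = 0 the discriminant would be the square of B.
  lead≢0 : A ≢ 0ℤ
  lead≢0 refl = D B (solve 2 (λ B C → B :* B := B :* B :- con (+ 4) :* con 0ℤ :* C) refl B C)
    where open ℤ-Solver

  quadratic-hasDegree : HasDegree P 2
  quadratic-hasDegree = lead≢0 , λ { (suc (suc (suc i))) _ → refl ; 1 (ℕ.s≤s ()) ; 2 (ℕ.s≤s (ℕ.s≤s ())) }

  -- Degrees add in a product. A constant factor divides A, B and C, hence divides 1 by the Bézout
  -- relation; two linear factors would make the discriminant a square; all other pairs of degrees
  -- give a product of degree above 2.
  quadratic-irreducible : Primitive A B C → Irreducible P
  quadratic-irreducible (u , v , w , bezout) = record
    { p∤1      = λ (Q Divides., QP≈1) → p∤1 (Q , QP≈1)
    ; split-∣1 = λ {X} {Y} P≈XY → Sum.map divides divides (split {X} {Y} P≈XY)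
    }
    where
    P² = proj₂ quadratic-hasDegree

    divides : ∀ {X} → ∃[ Z ] Z *ₚ X ≈ₚ 1ℤ ∷ [] → X ∣ₚ (1ℤ ∷ [])
    divides (Z , ZX≈1) = Z Divides., ZX≈1

    p∤1 : ¬ (∃[ Q ] Q *ₚ P ≈ₚ 1ℤ ∷ [])
    p∤1 (Q , QP≈1) with zero⊎degree Q
    ... | inj₁ Q≡0 with () ← trans (sym (QP≈1 0)) (trans (coeff-*ₚ Q P 0) (conv-zeroˡ (coeff Q) (coeff P) Q≡0 0))
    ... | inj₂ (d , top , above) = *-≢0 top lead≢0 (trans (sym (conv-top (coeff Q) (coeff P) d 2 above P²))
      (trans (sym (coeff-*ₚ Q P (d ℕ.+ 2))) (trans (QP≈1 (d ℕ.+ 2)) (vanish (ℕ.m≤n+m 2 d)))))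
      where
      vanish : ∀ {i} → 2 ℕ.≤ i → coeff (1ℤ ∷ []) i ≡ 0ℤ
      vanish (ℕ.s≤s _) = refl

    split : ∀ {X Y} → P ≈ₚ X *ₚ Y → (∃[ Z ] Z *ₚ X ≈ₚ 1ℤ ∷ []) ⊎ (∃[ Z ] Z *ₚ Y ≈ₚ 1ℤ ∷ [])
    split {X} {Y} P≈XY with zero⊎degree X | zero⊎degree Y
    ... | inj₁ X≡0 | _        = contradiction
      (trans (P≈XY 2) (trans (coeff-*ₚ X Y 2) (conv-zeroˡ (coeff X) (coeff Y) X≡0 2))) lead≢0
    ... | inj₂ _   | inj₁ Y≡0 = contradiction
      (trans (P≈XY 2) (trans (coeff-*ₚ X Y 2) (conv-zeroʳ (coeff X) (coeff Y) Y≡0 2))) lead≢0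
    ... | inj₂ (d , x≢0 , X↓) | inj₂ (e , y≢0 , Y↓) = degrees d e x≢0 X↓ y≢0 Y↓
      where
      P≡ : ∀ i → coeff P i ≡ conv (coeff X) (coeff Y) i
      P≡ i = trans (P≈XY i) (coeff-*ₚ X Y i)

      open ℤ-Solver

      degrees : ∀ d e → coeff X d ≢ 0ℤ → DegreeAtMost X d → coeff Y e ≢ 0ℤ → DegreeAtMost Y e →
        (∃[ Z ] Z *ₚ X ≈ₚ 1ℤ ∷ []) ⊎ (∃[ Z ] Z *ₚ Y ≈ₚ 1ℤ ∷ [])
      -- The Bézout relation of the coefficients of P = x Y exhibits the inverse of the constant x,
      -- namely u y₂ + v y₁ + w y₀.
      degrees zero e _ X⁰ _ _ = inj₁ (constant∣1 X (u ℤ.* y 2 ℤ.+ v ℤ.* y 1 ℤ.+ w ℤ.* y 0) X⁰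
        (trans (solve 7 (λ u v w y₂ y₁ y₀ x →
            (u :* y₂ :+ v :* y₁ :+ w :* y₀) :* x := u :* (x :* y₂) :+ v :* (x :* y₁) :+ w :* (x :* y₀))
            refl u v w (y 2) (y 1) (y 0) (coeff X 0))
          (trans (cong₂ ℤ._+_ (cong₂ ℤ._+_ (cong (u ℤ.*_) (P≡xy 2)) (cong (v ℤ.*_) (P≡xy 1)))
            (cong (w ℤ.*_) (P≡xy 0))) bezout)))
        where
        y = coeff Y
        P≡xy : ∀ i → coeff X 0 ℤ.* y i ≡ coeff P i
        P≡xy i = sym (trans (P≡ i) (conv-constˡ (coeff X) y X⁰ i))
      degrees (suc d) zero _ _ _ Y⁰ = inj₂ (constant∣1 Y (u ℤ.* x 2 ℤ.+ v ℤ.* x 1 ℤ.+ w ℤ.* x 0) Y⁰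
        (trans (solve 7 (λ u v w x₂ x₁ x₀ y →
            (u :* x₂ :+ v :* x₁ :+ w :* x₀) :* y := u :* (x₂ :* y) :+ v :* (x₁ :* y) :+ w :* (x₀ :* y))
            refl u v w (x 2) (x 1) (x 0) (coeff Y 0))
          (trans (cong₂ ℤ._+_ (cong₂ ℤ._+_ (cong (u ℤ.*_) (P≡xy 2)) (cong (v ℤ.*_) (P≡xy 1)))
            (cong (w ℤ.*_) (P≡xy 0))) bezout)))
        where
        x = coeff X
        P≡xy : ∀ i → x i ℤ.* coeff Y 0 ≡ coeff P i
        P≡xy i = sym (trans (P≡ i) (conv-constʳ x (coeff Y) Y⁰ i))
      -- The discriminant of (x₁ X + x₀) (y₁ X + y₀) is the square of x₀ y₁ - x₁ y₀.
      degrees 1 1 _ X¹ _ Y¹ = contradiction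
        (trans (solve 4 (λ x₀ x₁ y₀ y₁ →
            (x₀ :* y₁ :- x₁ :* y₀) :* (x₀ :* y₁ :- x₁ :* y₀) :=
            (x₀ :* y₁ :+ x₁ :* y₀) :* (x₀ :* y₁ :+ x₁ :* y₀) :- con (+ 4) :* (x₁ :* y₁) :* (x₀ :* y₀))
            refl (x 0) (x 1) (y 0) (y 1))
          (cong₂ ℤ._-_ (cong₂ ℤ._*_ (sym (P≡ 1)) (sym (P≡ 1)))
            (cong₂ ℤ._*_ (cong (+ 4 ℤ.*_) (sym (trans (P≡ 2) (conv-top x y 1 1 X¹ Y¹)))) (sym (P≡ 0)))))
        (D (x 0 ℤ.* y 1 ℤ.- x 1 ℤ.* y 0))
        where
        x = coeff X
        y = coeff Y
      -- The product would have a nonzero coefficient in a degree of at least 3.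
      degrees (suc d) (suc (suc e)) x≢0 X↓ y≢0 Y↓ = contradiction
        (trans (sym (conv-top (coeff X) (coeff Y) (suc d) (2 ℕ.+ e) X↓ Y↓)) (trans (sym (P≡ (suc d ℕ.+ (2 ℕ.+ e))))
          (P² (suc d ℕ.+ (2 ℕ.+ e)) (ℕ.s≤s (ℕ.≤-trans (ℕ.s≤s (ℕ.s≤s ℕ.z≤n)) (ℕ.m≤n+m (2 ℕ.+ e) d)))))) (*-≢0 x≢0 y≢0)
      degrees (suc (suc d)) 1 x≢0 X↓ y≢0 Y↓ = contradiction
        (trans (sym (conv-top (coeff X) (coeff Y) (2 ℕ.+ d) 1 X↓ Y↓)) (trans (sym (P≡ (2 ℕ.+ d ℕ.+ 1)))
          (P² (2 ℕ.+ d ℕ.+ 1) (ℕ.s≤s (ℕ.s≤s (ℕ.m≤n+m 1 d)))))) (*-≢0 x≢0 y≢0)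

-- Tails of continued fractions

-- For an explicit list of coefficients the terms of `eval P x` reduce to values of `evalℚ P`, so
-- estimates for convergents are estimates for the real number by computation alone.
evalℚ : Poly → ℚ → ℚ
evalℚ []      x = 0ℚ
evalℚ (a ∷ P) x = fromℤ a ℚ.+ x ℚ.* evalℚ P x

fromℤ-- : ∀ i j → fromℤ (i ℤ.- j) ≡ fromℤ i ℚ.- fromℤ j
fromℤ-- i j = trans (fromℤ-+ i (ℤ.- j)) (cong (fromℤ i ℚ.+_) (fromℤ-neg j))

Small-mono : ∀ {v D E} → (∀ n → 0ℚ ℚ.≤ v n) → E ℕ.≤ D → Small v D → Small v E
Small-mono v≥0 E≤D (N , s) = N , λ n N≤n → ℚ.≤-trans (*-monoʳ (v≥0 n) (⟦⟧-mono E≤D)) (s n N≤n)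

module _ (a : ℕ → ℕ) (a⁺ : Pos a) where

  tail : ℕ → ℚ
  tail = convergent (a ∘ suc) (a⁺ ∘ suc)

  convergent≥0 : ∀ n → 0ℚ ℚ.≤ convergent a a⁺ n
  convergent≥0 n = ℚ.nonNegative⁻¹ _ {{convergent-nonNeg a a⁺ n}}

module _ (a : ℕ → ℕ) (a⁺ : Pos a) where

  denominator-lower : ∀ n → ⟦ a 0 ⟧ ℚ.≤ denominator a a⁺ n
  denominator-lower n = p≤p+q (convergent≥0 (a ∘ suc) (a⁺ ∘ suc) n)

  denominator-upper : ∀ n → denominator a a⁺ n ℚ.≤ ⟦ suc (a 0) ⟧
  denominator-upper n = subst (denominator a a⁺ n ℚ.≤_) (trans (ℚ.+-comm ⟦ a 0 ⟧ 1ℚ) (sym (⟦⟧-+ 1 (a 0))))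
    (ℚ.+-monoʳ-≤ ⟦ a 0 ⟧ (convergent≤1 (a ∘ suc) (a⁺ ∘ suc) n))

  denominator≥0 : ∀ n → 0ℚ ℚ.≤ denominator a a⁺ n
  denominator≥0 n = ℚ.≤-trans 0≤1 (1≤denominator a a⁺ n)

module _ (a : ℕ → ℕ) (a⁺ : Pos a) (s : ℕ → ℕ) (s⁺ : Pos s) where

  -- The terms of ∣ ξ - α ∣ when ξ and α are both given by their convergents.
  convergents-dist : ℕ → ℚ
  convergents-dist n = dist (convergent a a⁺ n) (convergent s s⁺ n)

  convergents-dist≥0 : ∀ n → 0ℚ ℚ.≤ convergents-dist n
  convergents-dist≥0 n = ℚ.0≤∣p∣ (convergent a a⁺ n ℚ.- convergent s s⁺ n)

module _ (a : ℕ → ℕ) (a⁺ : Pos a) (s : ℕ → ℕ) (s⁺ : Pos s) (a₀≡s₀ : a 0 ≡ s 0) where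

  -- For a common first letter k, 1 / (k + t) - 1 / (k + u) = (u - t) / ((k + t) (k + u)).
  convergents-dist-scale : ∀ n →
    (denominator a a⁺ n ℚ.* denominator s s⁺ n) ℚ.* convergents-dist a a⁺ s s⁺ (suc n) ≡
    convergents-dist (a ∘ suc) (a⁺ ∘ suc) (s ∘ suc) (s⁺ ∘ suc) n
  convergents-dist-scale n = begin
    (d ℚ.* e) ℚ.* dist x y                  ≡⟨ cong ((d ℚ.* e) ℚ.*_) (reciprocal-dist ⟦ a 0 ⟧ t u x y
      (convergent*denominator a a⁺ n)
      (trans (cong (λ k → y ℚ.* (⟦ k ⟧ ℚ.+ u)) a₀≡s₀) (convergent*denominator s s⁺ n))
      (convergent-nonNeg a a⁺ (suc n)) (convergent-nonNeg s s⁺ (suc n))) ⟩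
    (d ℚ.* e) ℚ.* ((x ℚ.* y) ℚ.* dist t u)  ≡⟨ solve 5 (λ d e x y δ →
      (d :* e) :* ((x :* y) :* δ) := (x :* d) :* (y :* e) :* δ) refl d e x y (dist t u) ⟩
    (x ℚ.* d) ℚ.* (y ℚ.* e) ℚ.* dist t u    ≡⟨ cong₂ (λ p q → p ℚ.* q ℚ.* dist t u)
      (convergent*denominator a a⁺ n) (convergent*denominator s s⁺ n) ⟩
    1ℚ ℚ.* 1ℚ ℚ.* dist t u                  ≡⟨ ℚ.*-identityˡ (dist t u) ⟩
    dist t u                                ∎
    where
    open ≡-Reasoning
    open ℚ-Solver
    d = denominator a a⁺ n
    e = denominator s s⁺ n
    x = convergent a a⁺ (suc n)
    y = convergent s s⁺ (suc n)
    t = tail a a⁺ n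
    u = tail s s⁺ n

  Small-dist-step : ∀ {D} lo → (∀ n → ⟦ lo ⟧ ℚ.≤ denominator a a⁺ n ℚ.* denominator s s⁺ n) →
    Small (convergents-dist (a ∘ suc) (a⁺ ∘ suc) (s ∘ suc) (s⁺ ∘ suc)) D →
    Small (convergents-dist a a⁺ s s⁺) (lo ℕ.* D)
  Small-dist-step lo lo≤ = Small-step (convergents-dist≥0 a a⁺ s s⁺)
    (λ n → denominator a a⁺ n ℚ.* denominator s s⁺ n) convergents-dist-scale lo≤

  Apart-dist-step :
    Apart (convergents-dist (a ∘ suc) (a⁺ ∘ suc) (s ∘ suc) (s⁺ ∘ suc)) →
    Apart (convergents-dist a a⁺ s s⁺)
  Apart-dist-step = Apart-step (convergents-dist≥0 a a⁺ s s⁺)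
    (λ n → denominator a a⁺ n ℚ.* denominator s s⁺ n) convergents-dist-scale
    (suc (a 0) ℕ.* suc (s 0)) λ n → subst (denominator a a⁺ n ℚ.* denominator s s⁺ n ℚ.≤_)
      (sym (⟦⟧-* (suc (a 0)) (suc (s 0))))
      (*-mono (denominator≥0 a a⁺ n) (⟦⟧-nonNeg (suc (s 0))) (denominator-upper a a⁺ n) (denominator-upper s s⁺ n))

∣evalℚ∣ : Poly → (a : ℕ → ℕ) → Pos a → ℕ → ℚ
∣evalℚ∣ P a a⁺ n = ℚ.∣ evalℚ P (convergent a a⁺ n) ∣

∣evalℚ∣≥0 : ∀ P a a⁺ n → 0ℚ ℚ.≤ ∣evalℚ∣ P a a⁺ n
∣evalℚ∣≥0 P a a⁺ n = ℚ.0≤∣p∣ (evalℚ P (convergent a a⁺ n))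

∣*∣-nonNeg : ∀ {p q} → 0ℚ ℚ.≤ p → p ℚ.* ℚ.∣ q ∣ ≡ ℚ.∣ p ℚ.* q ∣
∣*∣-nonNeg {p} {q} p≥0 = trans (cong (ℚ._* ℚ.∣ q ∣) (sym (ℚ.0≤p⇒∣p∣≡p p≥0))) (sym (ℚ.∣p*q∣≡∣p∣*∣q∣ p q))

-- The substitution in degree 1: x (v + u (1 / x - k)) = u + (v - k u) x.
linear-scale : ∀ u v k t x → x ℚ.* (⟦ k ⟧ ℚ.+ t) ≡ 1ℚ →
  (⟦ k ⟧ ℚ.+ t) ℚ.* evalℚ (u ∷ v ℤ.- + k ℤ.* u ∷ []) x ≡ evalℚ (v ∷ u ∷ []) t
linear-scale u v k t x xd≡1 = begin
  d ℚ.* (U ℚ.+ x ℚ.* (fromℤ (v ℤ.- + k ℤ.* u) ℚ.+ x ℚ.* 0ℚ))  ≡⟨ cong (λ c → d ℚ.* (U ℚ.+ x ℚ.* (c ℚ.+ x ℚ.* 0ℚ)))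
    (trans (fromℤ-- v (+ k ℤ.* u)) (cong (λ p → V ℚ.- p) (fromℤ-* (+ k) u))) ⟩
  d ℚ.* (U ℚ.+ x ℚ.* (V ℚ.- K ℚ.* U ℚ.+ x ℚ.* 0ℚ))            ≡⟨ solve 5 (λ U V K t x →
    (K :+ t) :* (U :+ x :* (V :- K :* U :+ x :* con 0ℚ)) :=
    (K :+ t) :* U :+ (x :* (K :+ t)) :* (V :- K :* U)) refl U V K t x ⟩
  d ℚ.* U ℚ.+ (x ℚ.* d) ℚ.* (V ℚ.- K ℚ.* U)                   ≡⟨ cong (λ e → d ℚ.* U ℚ.+ e ℚ.* (V ℚ.- K ℚ.* U)) xd≡1 ⟩
  d ℚ.* U ℚ.+ 1ℚ ℚ.* (V ℚ.- K ℚ.* U)                          ≡⟨ solve 4 (λ U V K t →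
    (K :+ t) :* U :+ con 1ℚ :* (V :- K :* U) := V :+ t :* (U :+ t :* con 0ℚ)) refl U V K t ⟩
  V ℚ.+ t ℚ.* (U ℚ.+ t ℚ.* 0ℚ)                                ∎
  where
  open ≡-Reasoning
  open ℚ-Solver
  U = fromℤ u
  V = fromℤ v
  K = ⟦ k ⟧
  d = K ℚ.+ t

-- The substitution in degree 2. The reciprocal 1 / x is avoided by collecting the products x d and
-- replacing them by 1, which leaves identities of polynomials.
quadratic-scale : ∀ A B C k t x → x ℚ.* (⟦ k ⟧ ℚ.+ t) ≡ 1ℚ →
  ((⟦ k ⟧ ℚ.+ t) ℚ.* (⟦ k ⟧ ℚ.+ t)) ℚ.*
    evalℚ (A ∷ B ℤ.- + 2 ℤ.* + k ℤ.* A ∷ C ℤ.- + k ℤ.* B ℤ.+ + k ℤ.* + k ℤ.* A ∷ []) x ≡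
  evalℚ (C ∷ B ∷ A ∷ []) t
quadratic-scale A B C k t x xd≡1 = begin
  (d ℚ.* d) ℚ.* (α ℚ.+ x ℚ.* (fromℤ (B ℤ.- + 2 ℤ.* + k ℤ.* A) ℚ.+
    x ℚ.* (fromℤ (C ℤ.- + k ℤ.* B ℤ.+ + k ℤ.* + k ℤ.* A) ℚ.+ x ℚ.* 0ℚ)))
    ≡⟨ cong₂ (λ p q → (d ℚ.* d) ℚ.* (α ℚ.+ x ℚ.* (p ℚ.+ x ℚ.* (q ℚ.+ x ℚ.* 0ℚ)))) middle last ⟩
  (d ℚ.* d) ℚ.* (α ℚ.+ x ℚ.* (β ℚ.- ⟦ 2 ⟧ ℚ.* K ℚ.* α ℚ.+
    x ℚ.* (γ ℚ.- K ℚ.* β ℚ.+ K ℚ.* K ℚ.* α ℚ.+ x ℚ.* 0ℚ)))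
    ≡⟨ solve 5 (λ d x α p q → (d :* d) :* (α :+ x :* (p :+ x :* (q :+ x :* con 0ℚ))) :=
        d :* d :* α :+ (x :* d) :* (d :* p :+ (x :* d) :* q)) refl d x α
        (β ℚ.- ⟦ 2 ⟧ ℚ.* K ℚ.* α) (γ ℚ.- K ℚ.* β ℚ.+ K ℚ.* K ℚ.* α) ⟩
  d ℚ.* d ℚ.* α ℚ.+ (x ℚ.* d) ℚ.* (d ℚ.* (β ℚ.- ⟦ 2 ⟧ ℚ.* K ℚ.* α) ℚ.+
    (x ℚ.* d) ℚ.* (γ ℚ.- K ℚ.* β ℚ.+ K ℚ.* K ℚ.* α))
    ≡⟨ cong (λ e → d ℚ.* d ℚ.* α ℚ.+ e ℚ.* (d ℚ.* (β ℚ.- ⟦ 2 ⟧ ℚ.* K ℚ.* α) ℚ.+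
        e ℚ.* (γ ℚ.- K ℚ.* β ℚ.+ K ℚ.* K ℚ.* α))) xd≡1 ⟩
  d ℚ.* d ℚ.* α ℚ.+ 1ℚ ℚ.* (d ℚ.* (β ℚ.- ⟦ 2 ⟧ ℚ.* K ℚ.* α) ℚ.+
    1ℚ ℚ.* (γ ℚ.- K ℚ.* β ℚ.+ K ℚ.* K ℚ.* α))
    ≡⟨ solve 5 (λ α β γ K t → (K :+ t) :* (K :+ t) :* α :+ con 1ℚ :* ((K :+ t) :* (β :- con ⟦ 2 ⟧ :* K :* α) :+
        con 1ℚ :* (γ :- K :* β :+ K :* K :* α)) := γ :+ t :* (β :+ t :* (α :+ t :* con 0ℚ))) refl α β γ K t ⟩
  γ ℚ.+ t ℚ.* (β ℚ.+ t ℚ.* (α ℚ.+ t ℚ.* 0ℚ))    ∎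
  where
  open ≡-Reasoning
  open ℚ-Solver
  α = fromℤ A
  β = fromℤ B
  γ = fromℤ C
  K = ⟦ k ⟧
  d = K ℚ.+ t
  middle : fromℤ (B ℤ.- + 2 ℤ.* + k ℤ.* A) ≡ β ℚ.- ⟦ 2 ⟧ ℚ.* K ℚ.* α
  middle = trans (fromℤ-- B (+ 2 ℤ.* + k ℤ.* A)) (cong (λ p → β ℚ.- p)
    (trans (fromℤ-* (+ 2 ℤ.* + k) A) (cong (ℚ._* α) (fromℤ-* (+ 2) (+ k)))))
  last : fromℤ (C ℤ.- + k ℤ.* B ℤ.+ + k ℤ.* + k ℤ.* A) ≡ γ ℚ.- K ℚ.* β ℚ.+ K ℚ.* K ℚ.* α
  last = trans (fromℤ-+ (C ℤ.- + k ℤ.* B) (+ k ℤ.* + k ℤ.* A)) (cong₂ ℚ._+_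
    (trans (fromℤ-- C (+ k ℤ.* B)) (cong (λ p → γ ℚ.- p) (fromℤ-* (+ k) B)))
    (trans (fromℤ-* (+ k ℤ.* + k) A) (cong (ℚ._* α) (fromℤ-* (+ k) (+ k)))))

module _ (a : ℕ → ℕ) (a⁺ : Pos a) where

  private d = denominator a a⁺

  1≤d² : ∀ n → 1ℚ ℚ.≤ d n ℚ.* d n
  1≤d² n = *-mono 0≤1 (denominator≥0 a a⁺ n) (1≤denominator a a⁺ n) (1≤denominator a a⁺ n)

  d²-lower : ∀ n → ⟦ a 0 ℕ.* a 0 ⟧ ℚ.≤ d n ℚ.* d n
  d²-lower n = subst (ℚ._≤ d n ℚ.* d n) (sym (⟦⟧-* (a 0) (a 0)))
    (*-mono (⟦⟧-nonNeg (a 0)) (denominator≥0 a a⁺ n) (denominator-lower a a⁺ n) (denominator-lower a a⁺ n))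

  d²-upper : ∀ n → d n ℚ.* d n ℚ.≤ ⟦ suc (a 0) ℕ.* suc (a 0) ⟧
  d²-upper n = subst (d n ℚ.* d n ℚ.≤_) (sym (⟦⟧-* (suc (a 0)) (suc (a 0))))
    (*-mono (denominator≥0 a a⁺ n) (⟦⟧-nonNeg (suc (a 0))) (denominator-upper a a⁺ n) (denominator-upper a a⁺ n))

-- Linear and quadratic approximations

∣i-j∣≤ : ∀ i j {m n} → ℤ.∣ i ∣ ℕ.≤ m → ℤ.∣ j ∣ ℕ.≤ n → ℤ.∣ i ℤ.- j ∣ ℕ.≤ m ℕ.+ n
∣i-j∣≤ i j i≤m j≤n = ℕ.≤-trans (ℤ.∣i-j∣≤∣i∣+∣j∣ i j) (ℕ.+-mono-≤ i≤m j≤n)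

∣i+j∣≤ : ∀ i j {m n} → ℤ.∣ i ∣ ℕ.≤ m → ℤ.∣ j ∣ ℕ.≤ n → ℤ.∣ i ℤ.+ j ∣ ℕ.≤ m ℕ.+ n
∣i+j∣≤ i j i≤m j≤n = ℕ.≤-trans (ℤ.∣i+j∣≤∣i∣+∣j∣ i j) (ℕ.+-mono-≤ i≤m j≤n)

∣ki∣≤ : ∀ k i {m} → ℤ.∣ i ∣ ℕ.≤ m → ℤ.∣ + k ℤ.* i ∣ ℕ.≤ k ℕ.* m
∣ki∣≤ k i i≤m = ℕ.≤-trans (ℕ.≤-reflexive (ℤ.∣i*j∣≡∣i∣*∣j∣ (+ k) i)) (ℕ.*-monoʳ-≤ k i≤m)

-- `q` bounds the height of v + u X and `D` is the scale of its value. Prepending letters enlarges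
-- `q` and keeps `D`.
record LinearApprox (D : ℕ) (a : ℕ → ℕ) (a⁺ : Pos a) (q : ℕ) : Set where
  field
    u v   : ℤ
    u≤    : ℤ.∣ u ∣ ℕ.≤ q
    v≤    : ℤ.∣ v ∣ ℕ.≤ q
    small : Small (∣evalℚ∣ (v ∷ u ∷ []) a a⁺) D
    apart : Apart (∣evalℚ∣ (v ∷ u ∷ []) a a⁺)

-- The value is divided by a denominator d with 1 ≤ d ≤ k + 1, where k is the new letter: it stays
-- small because of the first bound and nonzero because of the second.
linear-step : ∀ {D} a (a⁺ : Pos a) q → LinearApprox D (a ∘ suc) (a⁺ ∘ suc) q →
              LinearApprox D a a⁺ (suc (a 0) ℕ.* q)
linear-step a a⁺ q L = record
  { u     = v ℤ.- + a 0 ℤ.* u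
  ; v     = u
  ; u≤    = ∣i-j∣≤ v (+ a 0 ℤ.* u) v≤ (∣ki∣≤ (a 0) u u≤)
  ; v≤    = ℕ.≤-trans u≤ (ℕ.m≤m+n q (a 0 ℕ.* q))
  ; small = Small-step₁ (∣evalℚ∣≥0 P a a⁺) (denominator a a⁺) scale (1≤denominator a a⁺) small
  ; apart = Apart-step (∣evalℚ∣≥0 P a a⁺) (denominator a a⁺) scale (suc (a 0)) (denominator-upper a a⁺) apart
  }
  where
  open LinearApprox L
  P = u ∷ v ℤ.- + a 0 ℤ.* u ∷ []
  scale : ∀ n → denominator a a⁺ n ℚ.* ∣evalℚ∣ P a a⁺ (suc n) ≡ ∣evalℚ∣ (v ∷ u ∷ []) (a ∘ suc) (a⁺ ∘ suc) n
  scale n = trans (∣*∣-nonNeg (denominator≥0 a a⁺ n)) (cong ℚ.∣_∣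
    (linear-scale u v (a 0) (tail a a⁺ n) (convergent a a⁺ (suc n)) (convergent*denominator a a⁺ n)))

-- For the polynomial X the value is x = 1 / d itself, with a 0 ≤ d ≤ a 0 + 1.
linear-base : ∀ a (a⁺ : Pos a) → LinearApprox (a 0) a a⁺ 1
linear-base a a⁺ = record
  { u     = 1ℤ
  ; v     = 0ℤ
  ; u≤    = ℕ.≤-refl
  ; v≤    = ℕ.z≤n
  ; small = subst (Small (∣evalℚ∣ P a a⁺)) (ℕ.*-identityʳ (a 0))
      (Small-step (∣evalℚ∣≥0 P a a⁺) (denominator a a⁺) scale (denominator-lower a a⁺) (0 , λ _ _ → ℚ.≤-refl))
  ; apart = Apart-step (∣evalℚ∣≥0 P a a⁺) (denominator a a⁺) scale (suc (a 0)) (denominator-upper a a⁺)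
      (1 , 0 , λ _ _ → ℚ.≤-refl)
  }
  where
  P = 0ℤ ∷ 1ℤ ∷ []
  scale : ∀ n → denominator a a⁺ n ℚ.* ∣evalℚ∣ P a a⁺ (suc n) ≡ 1ℚ
  scale n = trans (∣*∣-nonNeg (denominator≥0 a a⁺ n)) (cong ℚ.∣_∣ (trans
    (solve 2 (λ d x → d :* (con 0ℚ :+ x :* (con 1ℚ :+ x :* con 0ℚ)) := x :* d) refl
      (denominator a a⁺ n) (convergent a a⁺ (suc n)))
    (convergent*denominator a a⁺ n)))
    where open ℚ-Solver

-- vanishing says that [0, s 0, s 1, …] is a root of poly.
record QuadraticApprox (b D : ℕ) (a : ℕ → ℕ) (a⁺ : Pos a) (q : ℕ) : Set where
  field
    A B C         : ℤ
    A≤            : ℤ.∣ A ∣ ℕ.≤ q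
    B≤            : ℤ.∣ B ∣ ℕ.≤ q
    C≤            : ℤ.∣ C ∣ ℕ.≤ q
    discriminant  : disc A B C ≡ + (b ℕ.* b ℕ.+ 4)
    is-primitive  : Primitive A B C
    s             : ℕ → ℕ
    s⁺            : Pos s
  poly = C ∷ B ∷ A ∷ []
  field
    vanishing     : ∀ E → Small (∣evalℚ∣ poly s s⁺) E
    small         : Small (∣evalℚ∣ poly a a⁺) D
    apart         : Apart (∣evalℚ∣ poly a a⁺)
    small-dist    : Small (convergents-dist a a⁺ s s⁺) D
    apart-dist    : Apart (convergents-dist a a⁺ s s⁺)

-- x²G(1/x - k) has coefficients A′, B′, A when G has coefficients A, B, C.
module _ (A B C k : ℤ) where

  private
    A′ = C ℤ.- k ℤ.* B ℤ.+ k ℤ.* k ℤ.* A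
    B′ = B ℤ.- + 2 ℤ.* k ℤ.* A

  open ℤ-Solver

  substitute-disc : disc A′ B′ A ≡ disc A B C
  substitute-disc = solve 4 (λ A B C k →
    (B :- con (+ 2) :* k :* A) :* (B :- con (+ 2) :* k :* A) :-
    con (+ 4) :* (C :- k :* B :+ k :* k :* A) :* A
    := B :* B :- con (+ 4) :* A :* C) refl A B C k

  substitute-primitive : Primitive A B C → Primitive A′ B′ A
  substitute-primitive (u , v , w , bezout) =
    w , v ℤ.+ k ℤ.* w , u ℤ.+ + 2 ℤ.* k ℤ.* v ℤ.+ k ℤ.* k ℤ.* w ,
    trans (solve 7 (λ A B C k u v w →
      w :* (C :- k :* B :+ k :* k :* A) :+ (v :+ k :* w) :* (B :- con (+ 2) :* k :* A) :+
      (u :+ con (+ 2) :* k :* v :+ k :* k :* w) :* A := u :* A :+ v :* B :+ w :* C) refl A B C k u v w) bezout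

cons : ℕ → (ℕ → ℕ) → ℕ → ℕ
cons k s zero    = k
cons k s (suc n) = s n

cons-pos : ∀ {k s} → NonZero k → Pos s → Pos (cons k s)
cons-pos k⁺ s⁺ zero    = k⁺
cons-pos k⁺ s⁺ (suc n) = s⁺ n

-- The root of the new polynomial is obtained by prepending the same letter k to the root of the old
-- one. Values and distances are divided by at least 1, so `D` is kept; the price is the factor (k +
-- 1)² in the height.
quadratic-step : ∀ {b D} a (a⁺ : Pos a) q → QuadraticApprox b D (a ∘ suc) (a⁺ ∘ suc) q →
                 QuadraticApprox b D a a⁺ (suc (a 0) ℕ.* suc (a 0) ℕ.* q)
quadratic-step {b} {D} a a⁺ q F = record
  { A            = A′
  ; B            = B′
  ; C            = A
  ; A≤           = ℕ.≤-trans (∣i+j∣≤ (C ℤ.- + k ℤ.* B) (+ k ℤ.* + k ℤ.* A)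
      (∣i-j∣≤ C (+ k ℤ.* B) C≤ (∣ki∣≤ k B B≤))
      (subst (λ i → ℤ.∣ i ℤ.* A ∣ ℕ.≤ k ℕ.* k ℕ.* q) (ℤ.pos-* k k) (∣ki∣≤ (k ℕ.* k) A A≤)))
      -- The sum (1 + k + k²) q is completed to (k + 1)² q by k q. For `B≤` the sum (1 + 2 k) q is
      -- completed by k² q.
      (ℕ.≤-trans (ℕ.m≤m+n _ (k ℕ.* q)) (ℕ.≤-reflexive A-bound))
  ; B≤           = ℕ.≤-trans (∣i-j∣≤ B (+ 2 ℤ.* + k ℤ.* A) B≤
      (subst (λ i → ℤ.∣ i ℤ.* A ∣ ℕ.≤ 2 ℕ.* k ℕ.* q) (ℤ.pos-* 2 k) (∣ki∣≤ (2 ℕ.* k) A A≤)))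
      (ℕ.≤-trans (ℕ.m≤m+n _ (k ℕ.* k ℕ.* q)) (ℕ.≤-reflexive B-bound))
  ; C≤           = ℕ.≤-trans A≤ (ℕ.m≤n*m q (suc k ℕ.* suc k))
  ; discriminant = trans (substitute-disc A B C (+ k)) discriminant
  ; is-primitive = substitute-primitive A B C (+ k) is-primitive
  ; s            = cons k s
  ; s⁺           = cons-pos (a⁺ 0) s⁺
  ; vanishing    = λ E → Small-step₁ (∣evalℚ∣≥0 P s′ s′⁺) (λ n → denominator s′ s′⁺ n ℚ.* denominator s′ s′⁺ n)
      (scale s′ s′⁺ refl) (1≤d² s′ s′⁺) (vanishing E)
  ; small        = Small-step₁ (∣evalℚ∣≥0 P a a⁺) (λ n → denominator a a⁺ n ℚ.* denominator a a⁺ n)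
      (scale a a⁺ refl) (1≤d² a a⁺) small
  ; apart        = Apart-step (∣evalℚ∣≥0 P a a⁺) (λ n → denominator a a⁺ n ℚ.* denominator a a⁺ n)
      (scale a a⁺ refl) (suc k ℕ.* suc k) (d²-upper a a⁺) apart
  ; small-dist   = subst (Small (convergents-dist a a⁺ s′ s′⁺)) (ℕ.*-identityˡ D)
      (Small-dist-step a a⁺ s′ s′⁺ refl 1 (λ n → *-mono 0≤1 (denominator≥0 s′ s′⁺ n)
        (1≤denominator a a⁺ n) (1≤denominator s′ s′⁺ n)) small-dist)
  ; apart-dist   = Apart-dist-step a a⁺ s′ s′⁺ refl apart-dist
  }
  where
  open QuadraticApprox F
  k = a 0

  A-bound : q ℕ.+ k ℕ.* q ℕ.+ k ℕ.* k ℕ.* q ℕ.+ k ℕ.* q ≡ suc k ℕ.* suc k ℕ.* q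
  A-bound = solve 2 (λ k q → q :+ k :* q :+ k :* k :* q :+ k :* q := (con 1 :+ k) :* (con 1 :+ k) :* q) refl k q
    where open ℕ-Solver

  B-bound : q ℕ.+ 2 ℕ.* k ℕ.* q ℕ.+ k ℕ.* k ℕ.* q ≡ suc k ℕ.* suc k ℕ.* q
  B-bound = solve 2 (λ k q → q :+ con 2 :* k :* q :+ k :* k :* q := (con 1 :+ k) :* (con 1 :+ k) :* q) refl k q
    where open ℕ-Solver

  A′ = C ℤ.- + k ℤ.* B ℤ.+ + k ℤ.* + k ℤ.* A
  B′ = B ℤ.- + 2 ℤ.* + k ℤ.* A
  P = A ∷ B′ ∷ A′ ∷ []
  s′ = cons k s
  s′⁺ = cons-pos {k} {s} (a⁺ 0) s⁺

  -- Any word with first letter k is allowed, since the identity is applied both to `a` and to the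
  -- word `s′` of the root.
  scale : ∀ c (c⁺ : Pos c) → c 0 ≡ k → ∀ n →
    (denominator c c⁺ n ℚ.* denominator c c⁺ n) ℚ.* ∣evalℚ∣ P c c⁺ (suc n) ≡ ∣evalℚ∣ poly (c ∘ suc) (c⁺ ∘ suc) n
  scale c c⁺ c₀≡k n = trans (∣*∣-nonNeg (*-nonNeg (denominator≥0 c c⁺ n) (denominator≥0 c c⁺ n))) (cong ℚ.∣_∣
    (trans (cong (λ d → d ℚ.* d ℚ.* evalℚ P (convergent c c⁺ (suc n))) d≡)
      (quadratic-scale A B C k (tail c c⁺ n) (convergent c c⁺ (suc n))
        (subst (λ d → convergent c c⁺ (suc n) ℚ.* d ≡ 1ℚ) d≡ (convergent*denominator c c⁺ n)))))
    where
    d≡ : denominator c c⁺ n ≡ ⟦ k ⟧ ℚ.+ tail c c⁺ n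
    d≡ = cong (λ j → ⟦ j ⟧ ℚ.+ tail c c⁺ n) c₀≡k

-- The approximation within one block

n<2^n : ∀ n → n ℕ.< 2 ℕ.^ n
n<2^n zero    = ℕ.≤-refl
n<2^n (suc n) = ℕ.≤-trans (ℕ.+-mono-≤ (ℕ.m^n>0 2 n) (n<2^n n))
  (ℕ.≤-reflexive (cong (2 ℕ.^ n ℕ.+_) (sym (ℕ.+-identityʳ (2 ℕ.^ n)))))

lower*convergent≤1 : ∀ k a (a⁺ : Pos a) → k ℕ.≤ a 0 → ∀ n → ⟦ k ⟧ ℚ.* convergent a a⁺ (suc n) ℚ.≤ 1ℚ
lower*convergent≤1 k a a⁺ k≤a₀ n = ℚ.≤-trans
  (*-monoʳ (convergent≥0 a a⁺ (suc n)) (ℚ.≤-trans (⟦⟧-mono k≤a₀) (denominator-lower a a⁺ n)))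
  (ℚ.≤-reflexive (trans (ℚ.*-comm (denominator a a⁺ n) (convergent a a⁺ (suc n))) (convergent*denominator a a⁺ n)))

1≤upper*convergent : ∀ a (a⁺ : Pos a) n → 1ℚ ℚ.≤ ⟦ suc (a 0) ⟧ ℚ.* convergent a a⁺ (suc n)
1≤upper*convergent a a⁺ n = ℚ.≤-trans
  (ℚ.≤-reflexive (sym (trans (ℚ.*-comm (denominator a a⁺ n) (convergent a a⁺ (suc n))) (convergent*denominator a a⁺ n))))
  (*-monoʳ (convergent≥0 a a⁺ (suc n)) (denominator-upper a a⁺ n))

module _ (b : ℕ) (b⁺ : NonZero b) where

  private
    β = ⟦ b ⟧
    s : ℕ → ℕ
    s _ = b
    s⁺ : Pos s
    s⁺ _ = b⁺

  -- The minimal polynomial of [0, b, b, …]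
  blockPoly : Poly
  blockPoly = ℤ.-1ℤ ∷ + b ∷ 1ℤ ∷ []

  module _ (a : ℕ → ℕ) (a⁺ : Pos a) where

    -- For G = X² + b X - 1 one has x² G(1 / x - b) = - G(x), as [0, b, b, ...] is fixed by
    -- prepending b. Absolute values hide the sign, so G itself can be carried through any number of
    -- letters b.
    blockPoly-scale : a 0 ≡ b → ∀ n → (denominator a a⁺ n ℚ.* denominator a a⁺ n) ℚ.* ∣evalℚ∣ blockPoly a a⁺ (suc n) ≡
                      ∣evalℚ∣ blockPoly (a ∘ suc) (a⁺ ∘ suc) n
    blockPoly-scale a₀≡b n = begin
      (d ℚ.* d) ℚ.* ∣evalℚ∣ blockPoly a a⁺ (suc n)
        ≡⟨ ∣*∣-nonNeg (*-nonNeg (denominator≥0 a a⁺ n) (denominator≥0 a a⁺ n)) ⟩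
      ℚ.∣ (d ℚ.* d) ℚ.* (ℚ.- 1ℚ ℚ.+ x ℚ.* (β ℚ.+ x ℚ.* (1ℚ ℚ.+ x ℚ.* 0ℚ))) ∣
        ≡⟨ cong ℚ.∣_∣ (solve 3 (λ d x β →
          (d :* d) :* (:- con 1ℚ :+ x :* (β :+ x :* (con 1ℚ :+ x :* con 0ℚ))) :=
          :- (d :* d) :+ (x :* d) :* (β :* d :+ x :* d)) refl d x β) ⟩
      ℚ.∣ ℚ.- (d ℚ.* d) ℚ.+ (x ℚ.* d) ℚ.* (β ℚ.* d ℚ.+ x ℚ.* d) ∣
        ≡⟨ cong (λ e → ℚ.∣ ℚ.- (d ℚ.* d) ℚ.+ e ℚ.* (β ℚ.* d ℚ.+ e) ∣) (convergent*denominator a a⁺ n) ⟩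
      ℚ.∣ ℚ.- (d ℚ.* d) ℚ.+ 1ℚ ℚ.* (β ℚ.* d ℚ.+ 1ℚ) ∣
        ≡⟨ cong (λ d → ℚ.∣ ℚ.- (d ℚ.* d) ℚ.+ 1ℚ ℚ.* (β ℚ.* d ℚ.+ 1ℚ) ∣) (cong (λ k → ⟦ k ⟧ ℚ.+ t) a₀≡b) ⟩
      ℚ.∣ ℚ.- ((β ℚ.+ t) ℚ.* (β ℚ.+ t)) ℚ.+ 1ℚ ℚ.* (β ℚ.* (β ℚ.+ t) ℚ.+ 1ℚ) ∣
        ≡⟨ cong ℚ.∣_∣ (solve 2 (λ β t →
          :- ((β :+ t) :* (β :+ t)) :+ con 1ℚ :* (β :* (β :+ t) :+ con 1ℚ) :=
          :- (:- con 1ℚ :+ t :* (β :+ t :* (con 1ℚ :+ t :* con 0ℚ)))) refl β t) ⟩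
      ℚ.∣ ℚ.- evalℚ blockPoly t ∣
        ≡⟨ ℚ.∣-p∣≡∣p∣ (evalℚ blockPoly t) ⟩
      ℚ.∣ evalℚ blockPoly t ∣  ∎
      where
      open ≡-Reasoning
      open ℚ-Solver
      d = denominator a a⁺ n
      x = convergent a a⁺ (suc n)
      t = tail a a⁺ n

    ∣blockPoly∣≡dist : ∀ n → let x = convergent a a⁺ n in ∣evalℚ∣ blockPoly a a⁺ n ≡ dist (β ℚ.* x ℚ.+ x ℚ.* x) 1ℚ
    ∣blockPoly∣≡dist n = cong ℚ.∣_∣ (solve 2 (λ β x →
      :- con 1ℚ :+ x :* (β :+ x :* (con 1ℚ :+ x :* con 0ℚ)) := β :* x :+ x :* x :- con 1ℚ) refl β (convergent a a⁺ n))
      where open ℚ-Solver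

    -- Both b x and x² lie between 0 and 1, so b x + x² is within 1 of 1.
    blockPoly-small : b ℕ.≤ a 0 → Small (∣evalℚ∣ blockPoly a a⁺) 1
    blockPoly-small b≤a₀ = 1 , bound
      where
      bound : ∀ n → 1 ℕ.≤ n → 1ℚ ℚ.* ∣evalℚ∣ blockPoly a a⁺ n ℚ.≤ 1ℚ
      bound (suc n) _ = subst (ℚ._≤ 1ℚ) (sym (trans (ℚ.*-identityˡ _) (∣blockPoly∣≡dist (suc n))))
        (dist-≤ {β ℚ.* x ℚ.+ x ℚ.* x} {1ℚ} {1ℚ} (ℚ.+-mono-≤ (lower*convergent≤1 b a a⁺ b≤a₀ n)
            (*-mono x≥0 0≤1 x≤1 x≤1))
          (ℚ.≤-trans (p≤p+q (+-nonNeg (*-nonNeg (⟦⟧-nonNeg b) x≥0) (*-nonNeg x≥0 x≥0)))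
            (ℚ.≤-reflexive (ℚ.+-comm 1ℚ (β ℚ.* x ℚ.+ x ℚ.* x)))))
        where
        x = convergent a a⁺ (suc n)
        x≥0 = convergent≥0 a a⁺ (suc n)
        x≤1 = convergent≤1 a a⁺ (suc n)

  -- The constant word is its own tail, so the gain of b² per letter can be repeated E times, and
  -- (b²) ^ E ≥ 2 ^ E > E.
  blockPoly-vanishing : 2 ℕ.≤ b → ∀ E → Small (∣evalℚ∣ blockPoly s s⁺) E
  blockPoly-vanishing 2≤b E = Small-mono (∣evalℚ∣≥0 blockPoly s s⁺)
    (ℕ.≤-trans (ℕ.<⇒≤ (n<2^n E)) (ℕ.^-monoˡ-≤ E (ℕ.≤-trans 2≤b (ℕ.m≤m*n b b {{b⁺}})))) (power E)
    where
    power : ∀ E → Small (∣evalℚ∣ blockPoly s s⁺) ((b ℕ.* b) ℕ.^ E)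
    power zero    = blockPoly-small s s⁺ ℕ.≤-refl
    power (suc E) = Small-step (∣evalℚ∣≥0 blockPoly s s⁺) (λ n → denominator s s⁺ n ℚ.* denominator s s⁺ n)
      (blockPoly-scale s s⁺ refl) (d²-lower s s⁺) (power E)

  -- Within the block the polynomial and its root [0, b, b, ...] do not change. Only the estimates
  -- are carried along, and no height grows.
  record BlockApprox (D : ℕ) (a : ℕ → ℕ) (a⁺ : Pos a) : Set where
    field
      small      : Small (∣evalℚ∣ blockPoly a a⁺) D
      apart      : Apart (∣evalℚ∣ blockPoly a a⁺)
      small-dist : Small (convergents-dist a a⁺ s s⁺) D
      apart-dist : Apart (convergents-dist a a⁺ s s⁺)

  block-step : ∀ {D} a (a⁺ : Pos a) → a 0 ≡ b → BlockApprox D (a ∘ suc) (a⁺ ∘ suc) → BlockApprox (b ℕ.* b ℕ.* D) a a⁺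
  block-step a a⁺ a₀≡b T = record
    { small      = Small-step (∣evalℚ∣≥0 blockPoly a a⁺) (λ n → denominator a a⁺ n ℚ.* denominator a a⁺ n)
        (blockPoly-scale a a⁺ a₀≡b)
        (λ n → subst (λ k → ⟦ k ℕ.* k ⟧ ℚ.≤ denominator a a⁺ n ℚ.* denominator a a⁺ n) a₀≡b (d²-lower a a⁺ n)) small
    ; apart      = Apart-step (∣evalℚ∣≥0 blockPoly a a⁺) (λ n → denominator a a⁺ n ℚ.* denominator a a⁺ n)
        (blockPoly-scale a a⁺ a₀≡b) (suc (a 0) ℕ.* suc (a 0)) (d²-upper a a⁺) apart
    ; small-dist = Small-dist-step a a⁺ s s⁺ a₀≡b (b ℕ.* b) (λ n → subst (ℚ._≤ denominator a a⁺ n ℚ.* denominator s s⁺ n)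
        (sym (⟦⟧-* b b)) (*-mono (⟦⟧-nonNeg b) (denominator≥0 s s⁺ n)
          (subst (λ k → ⟦ k ⟧ ℚ.≤ denominator a a⁺ n) a₀≡b (denominator-lower a a⁺ n)) (denominator-lower s s⁺ n))) small-dist
    ; apart-dist = Apart-dist-step a a⁺ s s⁺ a₀≡b apart-dist
    }
    where open BlockApprox T

  -- When a 0 is much larger than b, the numbers x = [0, a 0, a 1, …] and
  -- τ = [0, b, b, …] satisfy x ≤ 1 / (2 (b + 1)) and 1 / (b + 1) ≤ τ.
  block-base : ∀ a (a⁺ : Pos a) → 2 ℕ.* suc b ℕ.≤ a 0 → BlockApprox 1 a a⁺
  block-base a a⁺ 2b≤a₀ = record
    { small      = blockPoly-small a a⁺ (ℕ.≤-trans (ℕ.≤-trans (ℕ.n≤1+n b) (ℕ.m≤n*m (suc b) 2)) 2b≤a₀)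
    -- Since x² ≤ x and (b + 1) x ≤ 1 / 2, the value 1 - b x - x² is at least 1 / 2.
    ; apart      = 2 , 1 , poly-apart
    ; small-dist = 0 , λ n _ → subst (ℚ._≤ 1ℚ) (sym (ℚ.*-identityˡ _)) (dist-≤
        (ℚ.≤-trans (convergent≤1 a a⁺ n) (1≤ (convergent≥0 s s⁺ n)))
        (ℚ.≤-trans (convergent≤1 s s⁺ n) (1≤ (convergent≥0 a a⁺ n))))
    -- The difference τ - x is at least 1 / (b + 1) - 1 / (2 (b + 1)).
    ; apart-dist = 2 ℕ.* suc b , 1 , dist-apart
    }
    where
    open ℚ-Solver
    open ℚ.≤-Reasoning

    1≤ : ∀ {p} → 0ℚ ℚ.≤ p → 1ℚ ℚ.≤ p ℚ.+ 1ℚ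
    1≤ {p} p≥0 = subst (1ℚ ℚ.≤_) (ℚ.+-comm 1ℚ p) (p≤p+q p≥0)

    1≤2-p : ∀ {p} → p ℚ.≤ 1ℚ → 1ℚ ℚ.≤ ⟦ 2 ⟧ ℚ.- p
    1≤2-p p≤1 = ℚ.+-monoʳ-≤ ⟦ 2 ⟧ (ℚ.neg-antimono-≤ p≤1)

    poly-apart : ∀ n → 1 ℕ.≤ n → 1ℚ ℚ.≤ ⟦ 2 ⟧ ℚ.* ∣evalℚ∣ blockPoly a a⁺ n
    poly-apart (suc n) _ = begin
      1ℚ                                             ≤⟨ 1≤2-p (lower*convergent≤1 (2 ℕ.* suc b) a a⁺ 2b≤a₀ n) ⟩
      ⟦ 2 ⟧ ℚ.- ⟦ 2 ℕ.* suc b ⟧ ℚ.* x                ≡⟨ cong (λ k → ⟦ 2 ⟧ ℚ.- k ℚ.* x)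
        (trans (⟦⟧-* 2 (suc b)) (cong (⟦ 2 ⟧ ℚ.*_) (⟦⟧-+ 1 b))) ⟩
      ⟦ 2 ⟧ ℚ.- ⟦ 2 ⟧ ℚ.* (1ℚ ℚ.+ β) ℚ.* x           ≡⟨ solve 2 (λ β x →
        con ⟦ 2 ⟧ :- con ⟦ 2 ⟧ :* (con 1ℚ :+ β) :* x := con ⟦ 2 ⟧ :* (con 1ℚ :- (β :* x :+ con 1ℚ :* x))) refl β x ⟩
      ⟦ 2 ⟧ ℚ.* (1ℚ ℚ.- (β ℚ.* x ℚ.+ 1ℚ ℚ.* x))      ≤⟨ *-monoˡ (⟦⟧-nonNeg 2) (ℚ.+-monoʳ-≤ 1ℚ (ℚ.neg-antimono-≤
        (ℚ.+-monoʳ-≤ (β ℚ.* x) (*-monoʳ (convergent≥0 a a⁺ (suc n)) (convergent≤1 a a⁺ (suc n)))))) ⟩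
      ⟦ 2 ⟧ ℚ.* (1ℚ ℚ.- (β ℚ.* x ℚ.+ x ℚ.* x))       ≤⟨ *-monoˡ (⟦⟧-nonNeg 2) (p≤∣p∣ (1ℚ ℚ.- (β ℚ.* x ℚ.+ x ℚ.* x))) ⟩
      ⟦ 2 ⟧ ℚ.* dist 1ℚ (β ℚ.* x ℚ.+ x ℚ.* x)        ≡⟨ cong (⟦ 2 ⟧ ℚ.*_)
        (trans (dist-sym 1ℚ (β ℚ.* x ℚ.+ x ℚ.* x)) (sym (∣blockPoly∣≡dist a a⁺ (suc n)))) ⟩
      ⟦ 2 ⟧ ℚ.* ∣evalℚ∣ blockPoly a a⁺ (suc n)       ∎
      where x = convergent a a⁺ (suc n)

    dist-apart : ∀ n → 1 ℕ.≤ n → 1ℚ ℚ.≤ ⟦ 2 ℕ.* suc b ⟧ ℚ.* convergents-dist a a⁺ s s⁺ n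
    dist-apart (suc n) _ = begin
      1ℚ                                              ≤⟨ 1≤2-p (lower*convergent≤1 (2 ℕ.* suc b) a a⁺ 2b≤a₀ n) ⟩
      ⟦ 2 ⟧ ℚ.* 1ℚ ℚ.- K ℚ.* x                        ≤⟨ ℚ.+-monoˡ-≤ (ℚ.- (K ℚ.* x))
        (*-monoˡ (⟦⟧-nonNeg 2) (1≤upper*convergent s s⁺ n)) ⟩
      ⟦ 2 ⟧ ℚ.* (⟦ suc b ⟧ ℚ.* τ) ℚ.- K ℚ.* x         ≡⟨ cong (λ p → p ℚ.- K ℚ.* x)
        (trans (sym (ℚ.*-assoc ⟦ 2 ⟧ ⟦ suc b ⟧ τ)) (cong (ℚ._* τ) (sym (⟦⟧-* 2 (suc b))))) ⟩
      K ℚ.* τ ℚ.- K ℚ.* x                             ≡⟨ solve 3 (λ K τ x → K :* τ :- K :* x := K :* (τ :- x)) refl K τ x ⟩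
      K ℚ.* (τ ℚ.- x)                                 ≤⟨ *-monoˡ (⟦⟧-nonNeg (2 ℕ.* suc b)) (p≤∣p∣ (τ ℚ.- x)) ⟩
      K ℚ.* dist τ x                                  ≡⟨ cong (K ℚ.*_) (dist-sym τ x) ⟩
      K ℚ.* dist x τ                                  ∎
      where
      x = convergent a a⁺ (suc n)
      τ = convergent s s⁺ (suc n)
      K = ⟦ 2 ℕ.* suc b ⟧

  quadratic-base : ∀ {D} a (a⁺ : Pos a) → 2 ℕ.≤ b → BlockApprox D a a⁺ → QuadraticApprox b D a a⁺ b
  quadratic-base a a⁺ 2≤b T = record
    { A            = 1ℤ
    ; B            = + b
    ; C            = ℤ.-1ℤ
    ; A≤           = ℕ.≤-trans (ℕ.n≤1+n 1) 2≤b
    ; B≤           = ℕ.≤-refl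
    ; C≤           = ℕ.≤-trans (ℕ.n≤1+n 1) 2≤b
    ; discriminant = cong (ℤ._+ + 4) (sym (ℤ.pos-* b b))
    ; is-primitive = 1ℤ , 0ℤ , 0ℤ , refl
    ; s            = s
    ; s⁺           = s⁺
    ; vanishing    = blockPoly-vanishing 2≤b
    ; small        = small
    ; apart        = apart
    ; small-dist   = small-dist
    ; apart-dist   = apart-dist
    }
    where open BlockApprox T

-- Growth of the block products

module _ (b l : ℕ → ℕ) where

  -- For `b` itself this is the exponential of the sum of logarithms in the hypothesis; for
  -- `suc ∘ b` it is the cost W of prepending the blocks.
  ∏^ : ℕ → ℕ
  ∏^ zero    = b 0 ℕ.^ l 0
  ∏^ (suc n) = ∏^ n ℕ.* b (suc n) ℕ.^ l (suc n)

^-cancelˡ-≤ : ∀ {m n} k → m ℕ.^ suc k ℕ.≤ n ℕ.^ suc k → m ℕ.≤ n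
^-cancelˡ-≤ k h = ℕ.≮⇒≥ λ n<m → ℕ.<⇒≱ (ℕ.^-monoˡ-< (suc k) n<m) h

*-^-comm : ∀ m n k → (m ℕ.* n) ℕ.^ k ≡ m ℕ.^ k ℕ.* n ℕ.^ k
*-^-comm m n zero    = refl
*-^-comm m n (suc k) = trans (cong (m ℕ.* n ℕ.*_) (*-^-comm m n k))
  (solve 4 (λ m n p q → m :* n :* (p :* q) := m :* p :* (n :* q)) refl m n (m ℕ.^ k) (n ℕ.^ k))
  where open ℕ-Solver

^-^-comm : ∀ m j k → (m ℕ.^ j) ℕ.^ k ≡ (m ℕ.^ k) ℕ.^ j
^-^-comm m j k = trans (ℕ.^-*-assoc m j k) (trans (cong (m ℕ.^_) (ℕ.*-comm j k)) (sym (ℕ.^-*-assoc m k j)))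

-- With L = ⌊log₂ n⌋, n < 2 ^ (L + 1) ≤ 4 ^ L if L ≥ 1, while L = 0 forces n ≤ 1. Having no constant
-- factor, the bound can be raised to powers and multiplied over the blocks.
n≤4^⌊log₂n⌋ : ∀ n → n ℕ.≤ 4 ℕ.^ ⌊log₂ n ⌋
n≤4^⌊log₂n⌋ n with ⌊log₂ n ⌋ | n<2^[1+⌊log₂n⌋] n
... | zero  | ℕ.s≤s n≤1 = n≤1
... | suc L | n<        = ℕ.≤-trans (ℕ.<⇒≤ n<) (ℕ.≤-trans
  (ℕ.^-monoʳ-≤ 2 (ℕ.≤-trans (ℕ.≤-reflexive (ℕ.+-comm 1 (suc L))) (ℕ.≤-trans (ℕ.+-monoʳ-≤ (suc L) (ℕ.s≤s ℕ.z≤n))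
    (ℕ.≤-reflexive (cong (suc L ℕ.+_) (sym (ℕ.+-identityʳ (suc L))))))))
  (ℕ.≤-reflexive (sym (ℕ.^-*-assoc 2 2 (suc L)))))

module _ (b l : ℕ → ℕ) (b⁺ : Pos b) where

  private
    logSum : ℕ → ℝ
    logSum n = ∑[0… n ] (λ k → fromℕ (l k) * log₂ (b k) {{b⁺ k}})

    -- The numerator of the term j of `logSum n` over the denominator j + 1.
    floorSum : ℕ → ℕ → ℕ
    floorSum j zero    = l 0 ℕ.* ⌊log₂ (b 0 ℕ.^ suc j) ⌋
    floorSum j (suc n) = floorSum j n ℕ.+ l (suc n) ℕ.* ⌊log₂ (b (suc n) ℕ.^ suc j) ⌋

    logSum-seq : ∀ j n → seq (logSum n) j ℚ.* ⟦ suc j ⟧ ≡ ⟦ floorSum j n ⟧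
    logSum-seq j = sum
      where
      term : ∀ k → seq (fromℕ (l k) * log₂ (b k) {{b⁺ k}}) j ℚ.* ⟦ suc j ⟧ ≡ ⟦ l k ℕ.* ⌊log₂ (b k ℕ.^ suc j) ⌋ ⟧
      term k = trans (ℚ.*-assoc ⟦ l k ⟧ (seq (log₂ (b k) {{b⁺ k}}) j) ⟦ suc j ⟧)
        (trans (cong (⟦ l k ⟧ ℚ.*_) (/-* (+ ⌊log₂ (b k ℕ.^ suc j) ⌋) j)) (sym (⟦⟧-* (l k) _)))
      sum : ∀ n → seq (logSum n) j ℚ.* ⟦ suc j ⟧ ≡ ⟦ floorSum j n ⟧
      sum zero    = term 0
      sum (suc n) = trans (ℚ.*-distribʳ-+ ⟦ suc j ⟧ (seq (logSum n) j) _)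
        (trans (cong₂ ℚ._+_ (sum n) (term (suc n))) (sym (⟦⟧-+ (floorSum j n) _)))

    ∏^-bound : ∀ j n → ∏^ b l n ℕ.^ suc j ℕ.≤ 4 ℕ.^ floorSum j n
    ∏^-bound j = bound
      where
      factor : ∀ k → (b k ℕ.^ l k) ℕ.^ suc j ℕ.≤ 4 ℕ.^ (l k ℕ.* ⌊log₂ (b k ℕ.^ suc j) ⌋)
      factor k = ℕ.≤-trans (ℕ.≤-reflexive (^-^-comm (b k) (l k) (suc j)))
        (ℕ.≤-trans (ℕ.^-monoˡ-≤ (l k) (n≤4^⌊log₂n⌋ (b k ℕ.^ suc j)))
          (ℕ.≤-reflexive (trans (ℕ.^-*-assoc 4 ⌊log₂ (b k ℕ.^ suc j) ⌋ (l k))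
            (cong (4 ℕ.^_) (ℕ.*-comm ⌊log₂ (b k ℕ.^ suc j) ⌋ (l k))))))
      bound : ∀ n → ∏^ b l n ℕ.^ suc j ℕ.≤ 4 ℕ.^ floorSum j n
      bound zero    = factor 0
      bound (suc n) = ℕ.≤-trans (ℕ.≤-reflexive (*-^-comm (∏^ b l n) (b (suc n) ℕ.^ l (suc n)) (suc j)))
        (ℕ.≤-trans (ℕ.*-mono-≤ (bound n) (factor (suc n)))
          (ℕ.≤-reflexive (sym (ℕ.^-distribˡ-+-* 4 (floorSum j n) (l (suc n) ℕ.* ⌊log₂ (b (suc n) ℕ.^ suc j) ⌋)))))

  module _ (log-growth : (λ n → log₂ (b (suc n)) {{b⁺ (suc n)}}) ∕ logSum ⟶+∞) where

    -- A single term j of the inequality between logarithms suffices: multiplied by j + 1 it becomes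
    -- one between natural numbers, which is exponentiated before the root of order j + 1 is taken.
    -- The multiplier 2 m instead of m pays for the base 4 in `∏^-bound`.
    ∏^-growth : ∀ m → ∃[ N ] ∀ n → N ℕ.≤ n → ∏^ b l n ℕ.^ m ℕ.≤ b (suc n)
    ∏^-growth m = let N , h = log-growth (fromℕ (2 ℕ.* m)) in N , λ n N≤n → bound n (proj₂ (h n N≤n))
      where
      bound : ∀ n → fromℕ (2 ℕ.* m) * logSum n < log₂ (b (suc n)) {{b⁺ (suc n)}} → ∏^ b l n ℕ.^ m ℕ.≤ b (suc n)
      bound n (ε , ε>0 , j , h) = ^-cancelˡ-≤ j (begin
        (∏^ b l n ℕ.^ m) ℕ.^ suc j      ≡⟨ ^-^-comm (∏^ b l n) m (suc j) ⟩
        (∏^ b l n ℕ.^ suc j) ℕ.^ m      ≤⟨ ℕ.^-monoˡ-≤ m (∏^-bound j n) ⟩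
        (4 ℕ.^ S) ℕ.^ m                 ≡⟨ ℕ.^-*-assoc 4 S m ⟩
        4 ℕ.^ (S ℕ.* m)                 ≡⟨ ℕ.^-*-assoc 2 2 (S ℕ.* m) ⟩
        2 ℕ.^ (2 ℕ.* (S ℕ.* m))         ≡⟨ cong (2 ℕ.^_) (trans (cong (2 ℕ.*_) (ℕ.*-comm S m)) (sym (ℕ.*-assoc 2 m S))) ⟩
        2 ℕ.^ (2 ℕ.* m ℕ.* S)           ≤⟨ ℕ.^-monoʳ-≤ 2 2mS≤L ⟩
        2 ℕ.^ L                         ≤⟨ 2^⌊log₂n⌋≤n (b (suc n) ℕ.^ suc j) {{ℕ.m^n≢0 (b (suc n)) (suc j) {{b⁺ (suc n)}}}} ⟩
        b (suc n) ℕ.^ suc j             ∎)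
        where
        open ℕ.≤-Reasoning
        S = floorSum j n
        L = ⌊log₂ (b (suc n) ℕ.^ suc j) ⌋
        2mS≤L : 2 ℕ.* m ℕ.* S ℕ.≤ L
        2mS≤L = ⟦⟧-cancel (subst₂ ℚ._≤_
          (trans (ℚ.*-assoc ⟦ 2 ℕ.* m ⟧ (seq (logSum n) j) ⟦ suc j ⟧)
            (trans (cong (⟦ 2 ℕ.* m ⟧ ℚ.*_) (logSum-seq j n)) (sym (⟦⟧-* (2 ℕ.* m) S))))
          (/-* (+ L) j)
          (*-monoʳ (⟦⟧-nonNeg (suc j)) (ℚ.≤-trans
            (p≤p+q {⟦ 2 ℕ.* m ⟧ ℚ.* seq (logSum n) j} (ℚ.<⇒≤ ε>0)) (h j ℕ.≤-refl))))

    module _ (l⁺ : Pos l) (b→∞ : ∀ k → ∃[ N ] ∀ n → N ℕ.≤ n → k ℕ.≤ b n) where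

      private
        N₀ = proj₁ (b→∞ 2)
        2≤b = proj₂ (b→∞ 2)
        W = ∏^ (suc ∘ b) l
        B = ∏^ b l

        B>0 : ∀ n → 0 ℕ.< B n
        B>0 zero    = ℕ.m^n>0 (b 0) {{b⁺ 0}} (l 0)
        B>0 (suc n) = ℕ.*-mono-≤ (B>0 n) (ℕ.m^n>0 (b (suc n)) {{b⁺ (suc n)}} (l (suc n)))

        B-lower : ∀ i → 2 ℕ.^ i ℕ.≤ B (i ℕ.+ N₀)
        B-lower zero    = B>0 N₀
        B-lower (suc i) = ℕ.≤-trans (ℕ.≤-reflexive (ℕ.*-comm 2 (2 ℕ.^ i))) (ℕ.*-mono-≤ (B-lower i)
          (ℕ.≤-trans (2≤b (suc i ℕ.+ N₀) (ℕ.m≤n+m N₀ (suc i)))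
            (ℕ.≤-trans (ℕ.≤-reflexive (sym (ℕ.^-identityʳ _)))
              (ℕ.^-monoʳ-≤ (b (suc i ℕ.+ N₀)) {{b⁺ _}} (ℕ.>-nonZero⁻¹ (l (suc i ℕ.+ N₀)) {{l⁺ _}})))))

        1+n≤n² : ∀ {n} → 2 ℕ.≤ n → suc n ℕ.≤ n ℕ.* n
        1+n≤n² {n} 2≤n = ℕ.≤-trans (ℕ.+-monoˡ-≤ n (ℕ.≤-trans (ℕ.n≤1+n 1) 2≤n))
          (ℕ.≤-trans (ℕ.≤-reflexive (cong (n ℕ.+_) (sym (ℕ.+-identityʳ n)))) (ℕ.*-monoˡ-≤ n 2≤n))

        W-upper : ∀ i → W (i ℕ.+ N₀) ℕ.≤ W N₀ ℕ.* (B (i ℕ.+ N₀) ℕ.* B (i ℕ.+ N₀))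
        W-upper zero    = ℕ.m≤m*n (W N₀) (B N₀ ℕ.* B N₀) {{ℕ.>-nonZero (ℕ.*-mono-≤ (B>0 N₀) (B>0 N₀))}}
        W-upper (suc i) = ℕ.≤-trans (ℕ.*-mono-≤ (W-upper i) (ℕ.^-monoˡ-≤ (l n) (1+n≤n² (2≤b n (ℕ.m≤n+m N₀ (suc i))))))
          (ℕ.≤-reflexive (trans (cong (W N₀ ℕ.* (B′ ℕ.* B′) ℕ.*_) (*-^-comm (b n) (b n) (l n)))
            (solve 3 (λ w p q → w :* (p :* p) :* (q :* q) := w :* ((p :* q) :* (p :* q))) refl (W N₀) B′ (b n ℕ.^ l n))))
          where
          open ℕ-Solver
          n = suc i ℕ.+ N₀
          B′ = B (i ℕ.+ N₀)

      -- From N₀ on, b + 1 ≤ b², so W n is at most a constant times (B n)². As B n grows at least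
      -- like 2 ^ (n - N₀), one more factor B n exceeds the constant, and W n ≤ (B n)³.
      weight-growth : ∀ m → ∃[ N ] ∀ n → N ℕ.≤ n → ∏^ (suc ∘ b) l n ℕ.^ m ℕ.≤ b (suc n)
      weight-growth m = let N , h = ∏^-growth (3 ℕ.* m) in N ℕ.⊔ (W N₀ ℕ.+ N₀) , λ n ≤n →
        ℕ.≤-trans (ℕ.≤-trans (ℕ.^-monoˡ-≤ m (W≤B³ n (ℕ.m⊔n≤o⇒n≤o N (W N₀ ℕ.+ N₀) ≤n)))
          (ℕ.≤-reflexive (ℕ.^-*-assoc (B n) 3 m)))
          (h n (ℕ.m⊔n≤o⇒m≤o N (W N₀ ℕ.+ N₀) ≤n))
        where
        W≤B³ : ∀ n → W N₀ ℕ.+ N₀ ℕ.≤ n → W n ℕ.≤ B n ℕ.^ 3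
        W≤B³ n ≤n = subst (λ n → W n ℕ.≤ B n ℕ.^ 3) (ℕ.m∸n+n≡m N₀≤n) (ℕ.≤-trans (W-upper i)
          (ℕ.≤-trans (ℕ.*-monoˡ-≤ (B (i ℕ.+ N₀) ℕ.* B (i ℕ.+ N₀)) C≤B)
            (ℕ.≤-reflexive (cong (λ p → B (i ℕ.+ N₀) ℕ.* (B (i ℕ.+ N₀) ℕ.* p)) (sym (ℕ.*-identityʳ _))))))
          where
          N₀≤n = ℕ.m+n≤o⇒n≤o (W N₀) ≤n
          i = n ℕ.∸ N₀
          -- From W N₀ + N₀ ≤ n follows W N₀ ≤ i < 2 ^ i.
          C≤B : W N₀ ℕ.≤ B (i ℕ.+ N₀)
          C≤B = ℕ.≤-trans (ℕ.m+n≤o⇒m≤o∸n (W N₀) ≤n) (ℕ.≤-trans (ℕ.<⇒≤ (n<2^n i)) (B-lower i))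

-- Passing through the blocks

-- The number that indexes `T` gains a factor per letter. It stands for a height bound in some uses
-- and for a scale of smallness in others.
module _ (b l : ℕ → ℕ) (b⁺ : Pos b) (l⁺ : Pos l) (T : (a : ℕ → ℕ) → Pos a → ℕ → Set) where

  AtBlock : ℕ → ℕ → Set
  AtBlock k = T (blocksFrom b l k (pred (l k))) (blocksFrom-pos l b⁺ k (pred (l k)))

  block-transport : ∀ k c → (∀ a a⁺ q → a 0 ≡ b k → T (a ∘ suc) (a⁺ ∘ suc) q → T a a⁺ (c ℕ.* q)) →
    ∀ q → AtBlock (suc k) q → AtBlock k (c ℕ.^ l k ℕ.* q)
  block-transport k c step q t = subst (λ e → AtBlock k (c ℕ.^ e ℕ.* q)) (ℕ.suc-pred (l k) {{l⁺ k}}) (run (pred (l k)))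
    where
    -- The word with parameter r starts with r + 1 copies of b k, hence the exponent.
    run : ∀ r → T (blocksFrom b l k r) (blocksFrom-pos l b⁺ k r) (c ℕ.^ suc r ℕ.* q)
    run zero    = subst (λ p → T _ (blocksFrom-pos l b⁺ k 0) (p ℕ.* q)) (sym (ℕ.*-identityʳ c)) (step _ _ q refl t)
    run (suc r) = subst (T _ (blocksFrom-pos l b⁺ k (suc r))) (sym (ℕ.*-assoc c (c ℕ.^ suc r) q)) (step _ _ _ refl (run r))

  blocks-transport : (∀ a a⁺ q → T (a ∘ suc) (a⁺ ∘ suc) q → T a a⁺ (suc (a 0) ℕ.* q)) →
    ∀ n q → AtBlock (suc n) q → AtBlock 0 (∏^ (suc ∘ b) l n ℕ.* q)
  blocks-transport step = go
    where
    one : ∀ k q → AtBlock (suc k) q → AtBlock k (suc (b k) ℕ.^ l k ℕ.* q)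
    one k = block-transport k (suc (b k)) λ a a⁺ q a₀≡b t → subst (λ c → T a a⁺ (suc c ℕ.* q)) a₀≡b (step a a⁺ q t)
    go : ∀ n q → AtBlock (suc n) q → AtBlock 0 (∏^ (suc ∘ b) l n ℕ.* q)
    go zero    q t = one 0 q t
    go (suc n) q t = subst (AtBlock 0) (sym (ℕ.*-assoc (∏^ (suc ∘ b) l n) (suc (b (suc n)) ℕ.^ l (suc n)) q))
      (go n (suc (b (suc n)) ℕ.^ l (suc n) ℕ.* q) (one (suc n) q t))

-- The quadratic number attached to an approximation

-- It lies strictly between b² and (b + 1)², since 2 b + 1 > 4.
nonSquare-b²+4 : ∀ b → 2 ℕ.≤ b → NonSquare (+ (b ℕ.* b ℕ.+ 4))
nonSquare-b²+4 b 2≤b z z²≡ with ℤ.∣ z ∣ ℕ.≤? b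
                             | trans (sym (ℤ.∣i*j∣≡∣i∣*∣j∣ z z)) (cong ℤ.∣_∣ z²≡)
... | yes z≤b | ∣z∣²≡ = ℕ.m+1+n≰m (b ℕ.* b) (subst (ℕ._≤ b ℕ.* b) ∣z∣²≡ (ℕ.*-mono-≤ z≤b z≤b))
... | no  z≰b | ∣z∣²≡ = ℕ.<-irrefl refl (begin-strict
  b ℕ.* b ℕ.+ 4                  <⟨ ℕ.+-monoʳ-< (b ℕ.* b) (ℕ.s≤s (ℕ.*-monoʳ-≤ 2 2≤b)) ⟩
  b ℕ.* b ℕ.+ suc (2 ℕ.* b)      ≡⟨ solve 1 (λ b →
    b :* b :+ (con 1 :+ con 2 :* b) := (con 1 :+ b) :* (con 1 :+ b)) refl b ⟩
  suc b ℕ.* suc b                ≤⟨ ℕ.*-mono-≤ (ℕ.≰⇒> z≰b) (ℕ.≰⇒> z≰b) ⟩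
  ℤ.∣ z ∣ ℕ.* ℤ.∣ z ∣            ≡⟨ ∣z∣²≡ ⟩
  b ℕ.* b ℕ.+ 4                  ∎)
  where
  open ℕ.≤-Reasoning
  open ℕ-Solver

evalℚ-neg : ∀ A B C x → evalℚ (ℤ.- C ∷ ℤ.- B ∷ ℤ.- A ∷ []) x ≡ ℚ.- evalℚ (C ∷ B ∷ A ∷ []) x
evalℚ-neg A B C x = trans
  (cong₂ (λ γ p → γ ℚ.+ x ℚ.* p) (fromℤ-neg C) (cong₂ (λ β α → β ℚ.+ x ℚ.* (α ℚ.+ x ℚ.* 0ℚ)) (fromℤ-neg B) (fromℤ-neg A)))
  (solve 4 (λ α β γ x → :- γ :+ x :* (:- β :+ x :* (:- α :+ x :* con 0ℚ)) :=
    :- (γ :+ x :* (β :+ x :* (α :+ x :* con 0ℚ)))) refl (fromℤ A) (fromℤ B) (fromℤ C) x)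
  where open ℚ-Solver

module _ {b D : ℕ} {a : ℕ → ℕ} {a⁺ : Pos a} {q : ℕ} where

  -- Minimal polynomials have a positive leading coefficient, but the substitutions do not control
  -- the sign of `A`.
  negate : QuadraticApprox b D a a⁺ q → QuadraticApprox b D a a⁺ q
  negate F = record
    { A            = ℤ.- A
    ; B            = ℤ.- B
    ; C            = ℤ.- C
    ; A≤           = subst (ℕ._≤ q) (sym (ℤ.∣-i∣≡∣i∣ A)) A≤
    ; B≤           = subst (ℕ._≤ q) (sym (ℤ.∣-i∣≡∣i∣ B)) B≤
    ; C≤           = subst (ℕ._≤ q) (sym (ℤ.∣-i∣≡∣i∣ C)) C≤
    ; discriminant = trans (solve 3 (λ A B C → :- B :* :- B :- con (+ 4) :* :- A :* :- C :=
        B :* B :- con (+ 4) :* A :* C) refl A B C) discriminant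
    ; is-primitive = let u , v , w , bezout = is-primitive in ℤ.- u , ℤ.- v , ℤ.- w ,
        trans (solve 6 (λ A B C u v w → :- u :* :- A :+ :- v :* :- B :+ :- w :* :- C := u :* A :+ v :* B :+ w :* C)
          refl A B C u v w) bezout
    ; s            = s
    ; s⁺           = s⁺
    ; vanishing    = λ E → let N , h = vanishing E in N , λ n N≤n →
        subst (λ v → ⟦ E ⟧ ℚ.* v ℚ.≤ 1ℚ) (∣neg∣ (convergent s s⁺ n)) (h n N≤n)
    ; small        = let N , h = small in N , λ n N≤n →
        subst (λ v → ⟦ D ⟧ ℚ.* v ℚ.≤ 1ℚ) (∣neg∣ (convergent a a⁺ n)) (h n N≤n)
    ; apart        = let k , N , h = apart in k , N , λ n N≤n →
        subst (λ v → 1ℚ ℚ.≤ ⟦ k ⟧ ℚ.* v) (∣neg∣ (convergent a a⁺ n)) (h n N≤n)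
    ; small-dist   = small-dist
    ; apart-dist   = apart-dist
    }
    where
    open QuadraticApprox F
    open ℤ-Solver
    ∣neg∣ : ∀ x → ℚ.∣ evalℚ poly x ∣ ≡ ℚ.∣ evalℚ (ℤ.- C ∷ ℤ.- B ∷ ℤ.- A ∷ []) x ∣
    ∣neg∣ x = trans (sym (ℚ.∣-p∣≡∣p∣ (evalℚ poly x))) (cong ℚ.∣_∣ (sym (evalℚ-neg A B C x)))

  module _ (2≤b : 2 ℕ.≤ b) where

    disc-nonSquare : (F : QuadraticApprox b D a a⁺ q) → let open QuadraticApprox F in NonSquare (disc A B C)
    disc-nonSquare F z z²≡ = nonSquare-b²+4 b 2≤b z (trans z²≡ (QuadraticApprox.discriminant F))

    positive-lead : QuadraticApprox b D a a⁺ q →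
      Σ[ F ∈ QuadraticApprox b D a a⁺ q ] 0ℤ ℤ.< QuadraticApprox.A F
    positive-lead F with ℤ.<-cmp 0ℤ (QuadraticApprox.A F)
    ... | tri< 0<A _ _ = F , 0<A
    ... | tri≈ _ 0≡A _ = contradiction (sym 0≡A) (lead≢0 {B = QuadraticApprox.B F} {QuadraticApprox.C F} (disc-nonSquare F))
    ... | tri> _ _ A<0 = negate F , ℤ.neg-mono-< A<0

  poly-height : (F : QuadraticApprox b D a a⁺ q) → height (QuadraticApprox.poly F) ℕ.≤ q
  poly-height F = ℕ.⊔-lub C≤ (ℕ.⊔-lub B≤ (ℕ.⊔-lub A≤ ℕ.z≤n))
    where open QuadraticApprox F

  -- No root has to be extracted: the continued fraction of `s` is one, as `vanishing` certifies.
  root-of : 2 ℕ.≤ b → (F : QuadraticApprox b D a a⁺ q) → 0ℤ ℤ.< QuadraticApprox.A F → AlgebraicReal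
  root-of 2≤b F A>0 = record
    { value       = continuedFraction s s⁺
    ; minPoly     = poly
    ; degree      = 2
    ; hasDegree   = quadratic-hasDegree {A} {B} {C} (disc-nonSquare 2≤b F)
    ; lead>0      = A>0
    ; irreducible = quadratic-irreducible (disc-nonSquare 2≤b F) is-primitive
    ; root        = Vanishing⇒≃0 (eval poly (continuedFraction s s⁺)) vanishing
    }
    where open QuadraticApprox F

-- The exponents of ξ

Small-absorb : ∀ {v} D k → Small v (D ℕ.* k) → Small (λ n → ⟦ k ⟧ ℚ.* v n) D
Small-absorb {v} D k (N , h) = N , λ n N≤n → subst (ℚ._≤ 1ℚ)
  (trans (cong (ℚ._* v n) (⟦⟧-* D k)) (ℚ.*-assoc ⟦ D ⟧ ⟦ k ⟧ (v n))) (h n N≤n)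

module _ (b l : ℕ → ℕ) (b⁺ : Pos b) (l⁺ : Pos l) where

  private
    a = blocks b l
    a⁺ = blocksFrom-pos l b⁺ 0 (pred (l 0))
    ξ = blockFraction b l b⁺
    W = ∏^ (suc ∘ b) l

  -- W n has the factor (b n + 1) ^ (l n) with l n ≥ 1.
  b<W : ∀ n → b n ℕ.< W n
  b<W n = ℕ.≤-trans (ℕ.≤-trans (ℕ.≤-reflexive (sym (ℕ.^-identityʳ (suc (b n)))))
    (ℕ.^-monoʳ-≤ (suc (b n)) (ℕ.>-nonZero⁻¹ (l n) {{l⁺ n}}))) (last n)
    where
    W>0 : ∀ n → 0 ℕ.< W n
    W>0 zero    = ℕ.m^n>0 (suc (b 0)) (l 0)
    W>0 (suc n) = ℕ.*-mono-≤ (W>0 n) (ℕ.m^n>0 (suc (b (suc n))) (l (suc n)))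
    last : ∀ n → suc (b n) ℕ.^ l n ℕ.≤ W n
    last zero    = ℕ.≤-refl
    last (suc n) = ℕ.m≤n*m _ (W n) {{ℕ.>-nonZero (W>0 n)}}

  linearApprox : ∀ n → LinearApprox (b (suc n)) a a⁺ (W n)
  linearApprox n = subst (LinearApprox (b (suc n)) a a⁺) (ℕ.*-identityʳ (W n))
    (blocks-transport b l b⁺ l⁺ (LinearApprox (b (suc n))) linear-step n 1 (linear-base _ _))

  quadraticApprox : ∀ n → let c = b (suc n) in 2 ℕ.≤ c → 2 ℕ.* suc c ℕ.≤ b (2 ℕ.+ n) →
    QuadraticApprox c ((c ℕ.* c) ℕ.^ l (suc n)) a a⁺ (W n ℕ.* W n ℕ.* c)
  quadraticApprox n 2≤c 2c≤b = subst (λ p → QuadraticApprox c D a a⁺ (p ℕ.* p ℕ.* c)) (ℕ.*-identityʳ (W n))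
    -- The height bound is written q² c, so that multiplying q by k + 1 accounts for the factor (k +
    -- 1)² of `quadratic-step`.
    (blocks-transport b l b⁺ l⁺ (λ a a⁺ q → QuadraticApprox c D a a⁺ (q ℕ.* q ℕ.* c)) step n 1
      (subst (QuadraticApprox c D _ _) (sym (ℕ.*-identityˡ c)) (quadratic-base c (b⁺ (suc n)) _ _ 2≤c block)))
    where
    open ℕ-Solver
    c = b (suc n)
    D = (c ℕ.* c) ℕ.^ l (suc n)
    step : ∀ a a⁺ q → QuadraticApprox c D (a ∘ suc) (a⁺ ∘ suc) (q ℕ.* q ℕ.* c) →
           QuadraticApprox c D a a⁺ (suc (a 0) ℕ.* q ℕ.* (suc (a 0) ℕ.* q) ℕ.* c)
    step a a⁺ q F = subst (QuadraticApprox c D a a⁺) (solve 3 (λ k q c →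
      k :* k :* (q :* q :* c) := k :* q :* (k :* q) :* c) refl (suc (a 0)) q c) (quadratic-step a a⁺ _ F)
    block : AtBlock b l b⁺ l⁺ (λ a a⁺ E → BlockApprox c (b⁺ (suc n)) E a a⁺) (suc n) D
    block = subst (AtBlock b l b⁺ l⁺ (λ a a⁺ E → BlockApprox c (b⁺ (suc n)) E a a⁺) (suc n)) (ℕ.*-identityʳ D)
      (block-transport b l b⁺ l⁺ (λ a a⁺ E → BlockApprox c (b⁺ (suc n)) E a a⁺) (suc n) (c ℕ.* c)
        (λ a a⁺ q a₀≡c → block-step c (b⁺ (suc n)) a a⁺ a₀≡c) 1 (block-base c (b⁺ (suc n)) _ _ 2c≤b))

  -- Here H = c³. The exponent m + 1 in `D-large` leaves a spare factor c³, which absorbs H(α) in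
  -- `root-at`.
  module _ (m c D : ℕ) (2≤c : 2 ℕ.≤ c) (D-large : (c ℕ.^ 3) ℕ.^ suc m ℕ.≤ D)
           (q : ℕ) (q≤ : q ℕ.≤ c ℕ.^ 3) (F : QuadraticApprox c D a a⁺ q) where

    private
      H = fromℕ (c ℕ.^ 3)
      instance
        c⁺  = ℕ.>-nonZero (ℕ.≤-trans (ℕ.s≤s ℕ.z≤n) 2≤c)
        c³⁺ = ℕ.m^n≢0 c 3

    open QuadraticApprox F

    polynomial-at : ∃[ P ] (Irreducible P × HasDegree P 2) × (fromℕ (height P) ≤ H) ×
      (0ℝ < ∣ eval P ξ ∣) × (∣ eval P ξ ∣ ≤ H ↑ (- fromℕ m))
    polynomial-at = poly ,
      (quadratic-irreducible (disc-nonSquare 2≤c F) is-primitive , quadratic-hasDegree {A} {B} {C} (disc-nonSquare 2≤c F)) ,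
      fromℕ-mono (ℕ.≤-trans (poly-height F) q≤) ,
      (Apart⇒>0 ∣ eval poly ξ ∣ apart) ,
      Small⇒≤↑ (∣ eval poly ξ ∣) (c ℕ.^ 3) m
        (Small-mono (∣evalℚ∣≥0 poly a a⁺) (ℕ.≤-trans (ℕ.^-monoʳ-≤ (c ℕ.^ 3) (ℕ.n≤1+n m)) D-large) small)

    root-at : 0ℤ ℤ.< A → ∃[ α ] (degree α ≡ 2) × (fromℕ (heightₐ α) ≤ H) ×
      (0ℝ < ∣ ξ - value α ∣) × (fromℕ (heightₐ α) * ∣ ξ - value α ∣ ≤ H ↑ (- fromℕ m))
    root-at A>0 = α , refl , fromℕ-mono height≤ ,
      (Apart⇒>0 ∣ ξ - value α ∣ apart-dist) ,
      Small⇒≤↑ (fromℕ (heightₐ α) * ∣ ξ - value α ∣) (c ℕ.^ 3) m (Small-absorb {convergents-dist a a⁺ s s⁺} ((c ℕ.^ 3) ℕ.^ m) (heightₐ α)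
        (Small-mono (convergents-dist≥0 a a⁺ s s⁺) (ℕ.≤-trans (ℕ.*-monoʳ-≤ ((c ℕ.^ 3) ℕ.^ m) height≤)
          (ℕ.≤-trans (ℕ.≤-reflexive (ℕ.*-comm ((c ℕ.^ 3) ℕ.^ m) (c ℕ.^ 3))) D-large)) small-dist))
      where
      α = root-of 2≤c F A>0
      height≤ : heightₐ α ℕ.≤ c ℕ.^ 3
      height≤ = ℕ.≤-trans (poly-height F) q≤

  module _ (b→∞ : ∀ k → ∃[ N ] ∀ n → N ℕ.≤ n → k ℕ.≤ b n)
           (l→∞ : ∀ k → ∃[ N ] ∀ n → N ℕ.≤ n → k ℕ.≤ l n)
           (growth : ∀ m → ∃[ N ] ∀ n → N ℕ.≤ n → W n ℕ.^ m ℕ.≤ b (suc n)) where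

    -- With H = W n the value is at most 1 / b₍ₙ₊₁₎ ≤ H ^ (-m) by `growth`, and H exceeds any bound
    -- because b n < W n.
    liouville : Liouville ξ
    liouville M = let m , M<m = <-fromℕ M in fromℕ m , exponent m , M<m
      where
      exponent : ∀ m → w₁ ξ (fromℕ m)
      exponent m H₀ = fromℕ (W n) , H₀≤ (ℕ.≤-trans (b-large n (ℕ.m≤n⊔m _ _)) (ℕ.<⇒≤ (b<W n))) , v ∷ u ∷ [] ,
        (λ { (suc (suc i)) _ → refl ; 1 (ℕ.s≤s ()) }) ,
        fromℕ-mono (ℕ.⊔-lub v≤ (ℕ.⊔-lub u≤ ℕ.z≤n)) ,
        Apart⇒>0 ∣Pξ∣ apart ,
        Small⇒≤↑ ∣Pξ∣ (W n) m {{ℕ.>-nonZero (ℕ.≤-trans (ℕ.s≤s ℕ.z≤n) (b<W n))}}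
          (Small-mono (∣evalℚ∣≥0 (v ∷ u ∷ []) a a⁺) (gap n (ℕ.m≤m⊔n _ _)) small)
        where
        h₀ = proj₁ (≤-fromℕ H₀)
        H₀≤ : ∀ {h} → h₀ ℕ.≤ h → H₀ ≤ fromℕ h
        H₀≤ = proj₂ (≤-fromℕ H₀)
        b-large = proj₂ (b→∞ h₀)
        gap = proj₂ (growth m)
        n = proj₁ (growth m) ℕ.⊔ proj₁ (b→∞ h₀)
        open LinearApprox (linearApprox n)
        ∣Pξ∣ = ∣ eval (v ∷ u ∷ []) ξ ∣

    quadratic-approximation : ∀ m h₀ → ∃[ c ] ∃[ D ] 2 ℕ.≤ c × h₀ ℕ.≤ c ℕ.^ 3 × (c ℕ.^ 3) ℕ.^ suc m ℕ.≤ D ×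
      ∃[ q ] q ℕ.≤ c ℕ.^ 3 × QuadraticApprox c D a a⁺ q
    quadratic-approximation m h₀ = c , (c ℕ.* c) ℕ.^ l (suc n) , 2≤c ,
      ℕ.≤-trans h₀≤c (ℕ.m≤m*n c (c ℕ.^ 2) {{ℕ.m^n≢0 c 2}}) , cube≤ ,
      W n ℕ.* W n ℕ.* c , height≤ , quadraticApprox n 2≤c 2c≤b
      where
      N₁ = proj₁ (b→∞ (2 ℕ.⊔ h₀))
      N₂ = proj₁ (l→∞ (3 ℕ.* suc m))
      N₃ = proj₁ (growth 1)
      N₄ = proj₁ (growth 2)
      -- N₁ makes c at least 2 and h₀, N₂ makes the block n + 1 long enough, N₃ gives W n ≤ c, and
      -- N₄ makes the letter after that block large.
      n = (N₁ ℕ.⊔ N₂) ℕ.⊔ (N₃ ℕ.⊔ N₄)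
      N₁⊔N₂≤n = ℕ.m≤m⊔n (N₁ ℕ.⊔ N₂) (N₃ ℕ.⊔ N₄)
      N₃⊔N₄≤n = ℕ.m≤n⊔m (N₁ ℕ.⊔ N₂) (N₃ ℕ.⊔ N₄)
      c = b (suc n)
      instance c⁺ = b⁺ (suc n)
      c-large : 2 ℕ.⊔ h₀ ℕ.≤ c
      c-large = proj₂ (b→∞ (2 ℕ.⊔ h₀)) (suc n) (ℕ.m≤n⇒m≤1+n (ℕ.m⊔n≤o⇒m≤o N₁ N₂ N₁⊔N₂≤n))
      2≤c = ℕ.m⊔n≤o⇒m≤o 2 h₀ c-large
      h₀≤c = ℕ.m⊔n≤o⇒n≤o 2 h₀ c-large
      -- As c + 1 ≤ W (n + 1), the product 2 (c + 1) is at most (W (n + 1))² ≤ b (n + 2).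
      2c≤b : 2 ℕ.* suc c ℕ.≤ b (2 ℕ.+ n)
      2c≤b = ℕ.≤-trans (ℕ.*-mono-≤ (ℕ.≤-trans 2≤c (ℕ.<⇒≤ (b<W (suc n))))
          (ℕ.≤-trans (b<W (suc n)) (ℕ.≤-reflexive (sym (ℕ.^-identityʳ (W (suc n)))))))
        (proj₂ (growth 2) (suc n) (ℕ.m≤n⇒m≤1+n (ℕ.m⊔n≤o⇒n≤o N₃ N₄ N₃⊔N₄≤n)))
      W≤c : W n ℕ.≤ c
      W≤c = subst (ℕ._≤ c) (ℕ.^-identityʳ (W n)) (proj₂ (growth 1) n (ℕ.m⊔n≤o⇒m≤o N₃ N₄ N₃⊔N₄≤n))
      height≤ : W n ℕ.* W n ℕ.* c ℕ.≤ c ℕ.^ 3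
      height≤ = ℕ.≤-trans (ℕ.*-monoˡ-≤ c (ℕ.*-mono-≤ W≤c W≤c))
        (ℕ.≤-reflexive (trans (ℕ.*-assoc c c c) (cong (λ p → c ℕ.* (c ℕ.* p)) (sym (ℕ.*-identityʳ c)))))
      -- With λ = l (n + 1) ≥ 3 (m + 1), the left side is c ^ (3 (m + 1)) ≤ c ^ λ ≤ (c²) ^ λ.
      cube≤ : (c ℕ.^ 3) ℕ.^ suc m ℕ.≤ (c ℕ.* c) ℕ.^ l (suc n)
      cube≤ = ℕ.≤-trans (ℕ.≤-reflexive (ℕ.^-*-assoc c 3 (suc m)))
        (ℕ.≤-trans (ℕ.^-monoʳ-≤ c (proj₂ (l→∞ (3 ℕ.* suc m)) (suc n) (ℕ.m≤n⇒m≤1+n (ℕ.m⊔n≤o⇒n≤o N₁ N₂ N₁⊔N₂≤n))))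
          (ℕ.^-monoˡ-≤ (l (suc n)) (ℕ.m≤m*n c c)))

    w₌2≡+∞ : sup (w₌ 2 ξ) ≡+∞
    w₌2≡+∞ M = let m , M<m = <-fromℕ M in fromℕ m , (λ H₀ →
      let h₀ , H₀≤ = ≤-fromℕ H₀
          c , D , 2≤c , h₀≤ , D-large , q , q≤ , F = quadratic-approximation m h₀
      in fromℕ (c ℕ.^ 3) , H₀≤ h₀≤ , polynomial-at m c D 2≤c D-large q q≤ F) , M<m

    w₌*2≡+∞ : sup (w₌* 2 ξ) ≡+∞
    w₌*2≡+∞ M = let m , M<m = <-fromℕ M in fromℕ m , (λ H₀ →
      let h₀ , H₀≤ = ≤-fromℕ H₀
          c , D , 2≤c , h₀≤ , D-large , q , q≤ , F₀ = quadratic-approximation m h₀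
          F , A>0 = positive-lead 2≤c F₀
      in fromℕ (c ℕ.^ 3) , H₀≤ h₀≤ , root-at m c D 2≤c D-large q q≤ F A>0) , M<m

⟶+∞⇒unbounded : (f : ℕ → ℕ) → (λ n → fromℕ (f n)) ⟶+∞ → ∀ k → ∃[ N ] ∀ n → N ℕ.≤ n → k ℕ.≤ f n
⟶+∞⇒unbounded f f→∞ k = let N , h = f→∞ (fromℕ k) in N , λ n N≤n → ℕ.<⇒≤ (fromℕ-<-cancel {k} {f n} (h n N≤n))

theorem1p2 : (b l : ℕ → ℕ) (b⁺ : Pos b) (l⁺ : Pos l) →
    (λ n → fromℕ (b n)) ⟶+∞ →
    (λ n → fromℕ (l n)) ⟶+∞ →
    (λ n → log₂ (b (suc n)) {{b⁺ (suc n)}})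
    ∕ (λ n → ∑[0… n ] (λ k → fromℕ (l k) * log₂ (b k) {{b⁺ k}})) ⟶+∞ →
    let ξ = blockFraction b l b⁺ in
    Liouville ξ × (sup (w₌ 2 ξ) ≡+∞) × (sup (w₌* 2 ξ) ≡+∞)
theorem1p2 b l b⁺ l⁺ b⟶ l⟶ log-growth =
  liouville b l b⁺ l⁺ b→∞ l→∞ growth , w₌2≡+∞ b l b⁺ l⁺ b→∞ l→∞ growth , w₌*2≡+∞ b l b⁺ l⁺ b→∞ l→∞ growth
  where
  b→∞ = ⟶+∞⇒unbounded b b⟶
  l→∞ = ⟶+∞⇒unbounded l l⟶
  growth = weight-growth b l b⁺ log-growth l⁺ b→∞
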